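{- Let $n$ be a positive integer and let $r$ be a positive integer with $r\equiv 2 \pmod{\phi\left(\binom{2n}{n}\right)\binom{2n}{n}}$. Then $$\nu_p\left(\sum_{k=0}^{2n}(-1)^k\binom{2n}{k}^r\right)=\nu_p\left(\binom{2n}{n}\right)$$ for each prime divisor $p$ of $\binom{2n}{n}$.
   Context: $\phi$ is the Euler totient function. For a prime $p$ and an integer $m\neq 0$, $\nu_p(m)$ is the greatest integer such that $p^{\nu_p(m)}\mid m$; $\nu_p(0)=+\infty$. -}

module Defs where

open import Data.Integer.Base as ℤ using (ℤ; +_; -1ℤ; 0ℤ; ∣_∣)
import Data.Integer.Divisibility as ℤ
import Data.Integer.Properties as ℤ
open import Data.List.Base using (applyUpTo; filter; length)
open import Data.Nat.Base
open import Data.Nat.Combinatorics using (_C_)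
open import Data.Nat.Coprimality using (coprime?)
open import Data.Nat.Divisibility using (_∣_; _∣?_; 1∣_; ∣⇒≤)
open import Data.Nat.Properties
open import Data.Fin.Base using (toℕ)
open import Data.Product.Base using (∃; _×_; _,_)
open import Relation.Binary.PropositionalEquality.Core using (_≡_; _≢_; refl; cong; sym)
open import Relation.Nullary using (yes; no; contradiction)
open import Relation.Nullary.Construct.Add.Supremum public using (_⁺; ⊤⁺; [_])
open import Algebra.Properties.CommutativeMonoid.Sum ℤ.+-0-commutativeMonoid using (sum-syntax)

φ : ℕ → ℕ
φ n = length (filter (λ k → coprime? k n) (applyUpTo suc n))

infix 4 _≡_[mod_]

_≡_[mod_] : ℤ → ℤ → ℕ → Set
a ≡ b [mod m ] = + m ℤ.∣ a ℤ.- b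

-- The greatest k ≤ bound such that p ^ k ∣ m.
greatestExponent : (p m bound : ℕ) → ℕ
greatestExponent p m zero = zero
greatestExponent p m (suc k) with p ^ suc k ∣? m
... | yes _ = suc k
... | no  _ = greatestExponent p m k

-- The value ⊤⁺ is +∞. Searching exponents up to ∣ m ∣ suffices when p ≥ 2,
-- since then k < p ^ k ≤ ∣ m ∣ whenever p ^ k divides m ≠ 0 (see ν-greatest).
-- For p < 2 the value is meaningless.
ν : ℕ → ℤ → ℕ ⁺
ν p (+ zero) = ⊤⁺
ν p m        = [ greatestExponent p ∣ m ∣ ∣ m ∣ ]

alternatingPowerSum : ℕ → ℕ → ℤ
alternatingPowerSum n r =
  ∑[ k < suc (2 * n) ] (-1ℤ ℤ.^ toℕ k ℤ.* + (((2 * n) C toℕ k) ^ r))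

greatestExponent-∣ : ∀ p m b → p ^ greatestExponent p m b ∣ m
greatestExponent-∣ p m zero = 1∣ m
greatestExponent-∣ p m (suc b) with p ^ suc b ∣? m
... | yes d = d
... | no  _ = greatestExponent-∣ p m b

greatestExponent-max : ∀ p m b {k} → k ≤ b → p ^ k ∣ m → k ≤ greatestExponent p m b
greatestExponent-max p m zero    k≤b _ = k≤b
greatestExponent-max p m (suc b) {k} k≤b d with p ^ suc b ∣? m
... | yes _ = k≤b
... | no ¬d with k ≟ suc b
...   | yes refl = contradiction d ¬d
...   | no  k≢   = greatestExponent-max p m b (≤-pred (≤∧≢⇒< k≤b k≢)) d

n<p^n : ∀ {p} → 2 ≤ p → ∀ n → n < p ^ n
n<p^n     _   zero    = z<s
n<p^n {p} 2≤p (suc n) = begin-strict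
  suc n               ≤⟨ n<p^n 2≤p n ⟩
  p ^ n               <⟨ m<m+n (p ^ n) (≤-<-trans z≤n (n<p^n 2≤p n)) ⟩
  p ^ n + p ^ n       ≡⟨ cong (λ x → p ^ n + x) (sym (+-identityʳ (p ^ n))) ⟩
  2 * p ^ n           ≤⟨ *-monoˡ-≤ (p ^ n) 2≤p ⟩
  p * p ^ n           ∎
  where open ≤-Reasoning

exponent-≤ : ∀ {p k m} → 2 ≤ p → p ^ k ∣ suc m → k ≤ suc m
exponent-≤ {k = k} 2≤p d = ≤-trans (<⇒≤ (n<p^n 2≤p k)) (∣⇒≤ d)

ν-greatest : ∀ {p} → 2 ≤ p → ∀ {m} → m ≢ 0ℤ →
  ∃ λ v → ν p m ≡ [ v ] × p ^ v ∣ ∣ m ∣ × (∀ {k} → p ^ k ∣ ∣ m ∣ → k ≤ v)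
ν-greatest 2≤p {+ zero} m≢0 = contradiction refl m≢0
ν-greatest {p} 2≤p {+ suc m} _ =
  _ , refl , greatestExponent-∣ p (suc m) (suc m) ,
  λ d → greatestExponent-max p (suc m) (suc m) (exponent-≤ 2≤p d) d
ν-greatest {p} 2≤p {ℤ.-[1+ m ]} _ =
  _ , refl , greatestExponent-∣ p (suc m) (suc m) ,
  λ d → greatestExponent-max p (suc m) (suc m) (exponent-≤ 2≤p d) d

{-# OPTIONS --safe #-}
module Submission where

-- Write N = 2n and M = C(N,n). The sums (`moment` below)
--   W(j,t) = Σₖ (-1)ᵏ C(N,k)ᵗ C(k,j) C(N-k,j)
-- satisfy W(j,t+1) = C(N,j) Σₗ C(l,j) W(l,t) by Vandermonde's convolution, and W(j,1) = 0 unless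
-- j = n, where it is (-1)ⁿ M. Hence W(j,t+1) = M z(t,j) for integers z(t,j) (`orbit`) obeying the
-- same recurrence; W(0,r) is the sum S(r) of the theorem, and S(2) = (-1)ⁿ M.
-- The recurrence is triangular, so modulo p the sequence t ↦ z(t,0), t ≥ 1, is purely
-- periodic. Let pᵛ be the exact power of p in M, and r = 2 + s with s > 0. As (p-1) pᵛ
-- divides s and s > v, S(2+s) ≡ S(2+s′) modulo pᵛ⁺¹ for every positive multiple s′ of s.
-- Taking for s′ a multiple of the period gives S(2+s′) = M z(s′+1,0) with
-- z(s′+1,0) ≡ z(1,0) = ±1 modulo p, so pᵛ⁺¹ does not divide S(r) = M z(r-1,0), and p does
-- not divide z(r-1,0).

open import Defs
open import Data.Integer.Base as ℤ using (ℤ; +_; 0ℤ; 1ℤ; -1ℤ; ∣_∣)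
import Data.Integer.Properties as ℤ
import Data.Integer.Divisibility.Signed as ℤ
open import Data.Integer.Tactic.RingSolver using (solve-∀)
open import Data.Nat.Tactic.RingSolver using () renaming (solve-∀ to ℕ-solve-∀)
open import Data.Bool.Base using (if_then_else_)
open import Data.List.Base using (applyUpTo; filter; length)
open import Data.Nat.Base
open import Data.Nat.Combinatorics
open import Data.Nat.Divisibility
open import Data.Nat.DivMod using (m/n*n≡m)
open import Data.Nat.Coprimality using (Coprime; coprime?; coprime-+; coprime-divisor)
open import Data.Nat.Induction using (<-rec)
open import Data.Nat.ListAction using () renaming (sum to sumᴸ)
open import Data.Nat.Primality
open import Data.Nat.Properties
open import Data.Fin.Base using (Fin; zero; suc; toℕ; fromℕ; fromℕ<; inject₁; punchIn)
open import Data.Fin.Properties using (toℕ-inject₁; toℕ-fromℕ; toℕ<n; toℕ-fromℕ<; toℕ-injective; punchInᵢ≢i)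
open import Data.Product.Base using (∃; _×_; _,_)
open import Data.Sum.Base using (inj₁; inj₂)
open import Function.Base using (_∘_)
open import Relation.Binary.Bundles using (Setoid)
open import Relation.Binary.PropositionalEquality
open import Relation.Nullary using (¬_; Dec; does; yes; no; contradiction)
open import Relation.Unary using (Pred; Decidable)
open import Algebra.Properties.Semiring.Sum ℤ.+-*-semiring
  using (sum; sum-syntax; sum-cong-≗; sum-replicate-zero; sum-remove; sum-init-last; ∑-distrib-+; ∑-comm; *-distribˡ-sum)
open import Algebra.Properties.CommutativeSemigroup ℤ.*-commutativeSemigroup using (x∙yz≈y∙xz)
import Algebra.Properties.CommutativeSemigroup ℤ.+-commutativeSemigroup as ℤ+
import Algebra.Properties.CommutativeSemigroup +-commutativeSemigroup as ℕ+
import Algebra.Properties.CommutativeSemigroup *-commutativeSemigroup as ℕ*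
import Relation.Binary.Reasoning.Setoid as SetoidReasoning

-- Congruences

-- Unlike Defs._≡_[mod_], a record lets Agda infer both sides of a congruence.
infix 4 _≈_mod_
record _≈_mod_ (a b : ℤ) (m : ℕ) : Set where
  constructor congruent
  field difference : + m ℤ.∣ a ℤ.- b
open _≈_mod_

module _ {m : ℕ} where

  ≈-reflexive : ∀ {a b} → a ≡ b → a ≈ b mod m
  ≈-reflexive {a} refl = congruent (ℤ.divides 0ℤ (ℤ.+-inverseʳ a))

  ≈-refl : ∀ {a} → a ≈ a mod m
  ≈-refl = ≈-reflexive refl

  ≈-sym : ∀ {a b} → a ≈ b mod m → b ≈ a mod m
  ≈-sym {a} {b} (congruent d) = congruent (subst (+ m ℤ.∣_) (swap a b) (ℤ.∣m⇒∣-m d))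
    where
    swap : ∀ a b → ℤ.- (a ℤ.- b) ≡ b ℤ.- a
    swap = solve-∀

  ≈-trans : ∀ {a b c} → a ≈ b mod m → b ≈ c mod m → a ≈ c mod m
  ≈-trans {a} {b} {c} (congruent d) (congruent e) =
    congruent (subst (+ m ℤ.∣_) (telescope a b c) (ℤ.∣m∣n⇒∣m+n d e))
    where
    telescope : ∀ a b c → (a ℤ.- b) ℤ.+ (b ℤ.- c) ≡ a ℤ.- c
    telescope = solve-∀

  +-cong-≈ : ∀ {a b c d} → a ≈ b mod m → c ≈ d mod m → a ℤ.+ c ≈ b ℤ.+ d mod m
  +-cong-≈ {a} {b} {c} {d} (congruent p) (congruent q) =
    congruent (subst (+ m ℤ.∣_) (regroup a b c d) (ℤ.∣m∣n⇒∣m+n p q))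
    where
    regroup : ∀ a b c d → (a ℤ.- b) ℤ.+ (c ℤ.- d) ≡ (a ℤ.+ c) ℤ.- (b ℤ.+ d)
    regroup = solve-∀

  *-cong-≈ : ∀ {a b c d} → a ≈ b mod m → c ≈ d mod m → a ℤ.* c ≈ b ℤ.* d mod m
  *-cong-≈ {a} {b} {c} {d} (congruent p) (congruent q) =
    congruent (subst (+ m ℤ.∣_) (regroup a b c d) (ℤ.∣m∣n⇒∣m+n (ℤ.∣n⇒∣m*n c p) (ℤ.∣n⇒∣m*n b q)))
    where
    regroup : ∀ a b c d → c ℤ.* (a ℤ.- b) ℤ.+ b ℤ.* (c ℤ.- d) ≡ a ℤ.* c ℤ.- b ℤ.* d
    regroup = solve-∀

  -‿cong-≈ : ∀ {a b c d} → a ≈ b mod m → c ≈ d mod m → a ℤ.- c ≈ b ℤ.- d mod m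
  -‿cong-≈ {a} {b} {c} {d} (congruent p) (congruent q) =
    congruent (subst (+ m ℤ.∣_) (regroup a b c d) (ℤ.∣m∣n⇒∣m-n p q))
    where
    regroup : ∀ a b c d → (a ℤ.- b) ℤ.- (c ℤ.- d) ≡ (a ℤ.- c) ℤ.- (b ℤ.- d)
    regroup = solve-∀

  ^-cong-≈ : ∀ {a b} k → a ≈ b mod m → a ℤ.^ k ≈ b ℤ.^ k mod m
  ^-cong-≈ zero    _   = ≈-refl
  ^-cong-≈ (suc k) a≈b = *-cong-≈ a≈b (^-cong-≈ k a≈b)

  sum-cong-≈ : ∀ {n} {f g : Fin n → ℤ} → (∀ i → f i ≈ g i mod m) → sum f ≈ sum g mod m
  sum-cong-≈ {zero}  f≈g = ≈-refl
  sum-cong-≈ {suc n} f≈g = +-cong-≈ (f≈g zero) (sum-cong-≈ (f≈g ∘ suc))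

  ∣⇒≈0 : ∀ {a} → m ∣ ∣ a ∣ → a ≈ 0ℤ mod m
  ∣⇒≈0 {a} d = congruent (subst (+ m ℤ.∣_) (sym (ℤ.+-identityʳ a)) (ℤ.∣ᵤ⇒∣ d))

  ≈0⇒∣ : ∀ {a} → a ≈ 0ℤ mod m → m ∣ ∣ a ∣
  ≈0⇒∣ {a} (congruent d) = ℤ.∣⇒∣ᵤ (subst (+ m ℤ.∣_) (ℤ.+-identityʳ a) d)

≈-setoid : ℕ → Setoid _ _
≈-setoid m = record
  { Carrier = ℤ
  ; _≈_ = _≈_mod m
  ; isEquivalence = record { refl = ≈-refl ; sym = ≈-sym ; trans = ≈-trans }
  }

module ≈-Reasoning (m : ℕ) = SetoidReasoning (≈-setoid m)

-- Binomial sums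

binom : ℕ → ℕ → ℤ
binom n k = + (n C k)

pascal : ∀ n k → binom (suc n) (suc k) ≡ binom n k ℤ.+ binom n (suc k)
pascal n k = cong +_ (sym (nCk+nC[k+1]≡[n+1]C[k+1] n k))

binom-< : ∀ {n k} → n < k → binom n k ≡ 0ℤ
binom-< n<k = cong +_ (k>n⇒nCk≡0 n<k)

-- The value at 0 of (1 + E)ᵐ f, where E is the shift operator.
shiftSum : (ℕ → ℤ) → ℕ → ℤ
shiftSum f zero    = f 0
shiftSum f (suc m) = shiftSum f m ℤ.+ shiftSum (f ∘ suc) m

∑-zero : ∀ {n} {f : Fin n → ℤ} → (∀ i → f i ≡ 0ℤ) → sum f ≡ 0ℤ
∑-zero {n} f≡0 = trans (sum-cong-≗ f≡0) (sum-replicate-zero n)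

-- Any bound b > m serves, since `binom m k` vanishes for k > m; hence sums over all k ≤ N can be
-- evaluated for every m ≤ N. The induction is Pascal's rule.
binomialSum : ∀ f {m b} → m < b →
  ∑[ k < b ] (binom m (toℕ k) ℤ.* f (toℕ k)) ≡ shiftSum f m
binomialSum f {zero} {suc b} _ = begin
  1ℤ ℤ.* f 0 ℤ.+ ∑[ k < b ] (0ℤ ℤ.* f (suc (toℕ k)))
    ≡⟨ cong₂ ℤ._+_ (ℤ.*-identityˡ (f 0)) (∑-zero {b} (λ k → ℤ.*-zeroˡ (f (suc (toℕ k))))) ⟩
  f 0 ℤ.+ 0ℤ
    ≡⟨ ℤ.+-identityʳ (f 0) ⟩
  f 0 ∎
  where open ≡-Reasoning
binomialSum f {suc m} {suc b} (s≤s m<b) = begin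
  1ℤ ℤ.* f 0 ℤ.+ ∑[ k < b ] (binom (suc m) (suc (toℕ k)) ℤ.* f (suc (toℕ k)))
    ≡⟨ cong (λ s → 1ℤ ℤ.* f 0 ℤ.+ s) (sum-cong-≗ {b} λ k → trans
         (cong (ℤ._* f (suc (toℕ k))) (pascal m (toℕ k)))
         (ℤ.*-distribʳ-+ (f (suc (toℕ k))) (binom m (toℕ k)) (binom m (suc (toℕ k))))) ⟩
  1ℤ ℤ.* f 0 ℤ.+ ∑[ k < b ] (L k ℤ.+ R k)
    ≡⟨ cong (λ s → 1ℤ ℤ.* f 0 ℤ.+ s) (∑-distrib-+ L R) ⟩
  1ℤ ℤ.* f 0 ℤ.+ (sum L ℤ.+ sum R)
    ≡⟨ swap (1ℤ ℤ.* f 0) (sum L) (sum R) ⟩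
  (1ℤ ℤ.* f 0 ℤ.+ sum R) ℤ.+ sum L
    ≡⟨ cong₂ ℤ._+_ (binomialSum f (m<n⇒m<1+n m<b)) (binomialSum (f ∘ suc) m<b) ⟩
  shiftSum f (suc m) ∎
  where
  open ≡-Reasoning
  L R : Fin b → ℤ
  L k = binom m (toℕ k) ℤ.* f (suc (toℕ k))
  R k = binom m (suc (toℕ k)) ℤ.* f (suc (toℕ k))
  swap : ∀ x y z → x ℤ.+ (y ℤ.+ z) ≡ (x ℤ.+ z) ℤ.+ y
  swap = solve-∀

shiftSum-cong : ∀ {f g} → (∀ k → f k ≡ g k) → ∀ m → shiftSum f m ≡ shiftSum g m
shiftSum-cong f≡g zero    = f≡g 0
shiftSum-cong f≡g (suc m) = cong₂ ℤ._+_ (shiftSum-cong f≡g m) (shiftSum-cong (f≡g ∘ suc) m)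

shiftSum-+ : ∀ f g m → shiftSum (λ k → f k ℤ.+ g k) m ≡ shiftSum f m ℤ.+ shiftSum g m
shiftSum-+ f g zero    = refl
shiftSum-+ f g (suc m) = trans
  (cong₂ ℤ._+_ (shiftSum-+ f g m) (shiftSum-+ (f ∘ suc) (g ∘ suc) m))
  (ℤ+.interchange (shiftSum f m) (shiftSum g m) (shiftSum (f ∘ suc) m) (shiftSum (g ∘ suc) m))

shiftSum-* : ∀ c f m → shiftSum (λ k → c ℤ.* f k) m ≡ c ℤ.* shiftSum f m
shiftSum-* c f zero    = refl
shiftSum-* c f (suc m) = trans
  (cong₂ ℤ._+_ (shiftSum-* c f m) (shiftSum-* c (f ∘ suc) m))
  (sym (ℤ.*-distribˡ-+ c (shiftSum f m) (shiftSum (f ∘ suc) m)))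

-- The binomial theorem: on the powers of x the shift E acts as multiplication by x.
shiftSum-^ : ∀ x m → shiftSum (x ℤ.^_) m ≡ (1ℤ ℤ.+ x) ℤ.^ m
shiftSum-^ x zero    = refl
shiftSum-^ x (suc m) = begin
  shiftSum (x ℤ.^_) m ℤ.+ shiftSum (λ k → x ℤ.* x ℤ.^ k) m
    ≡⟨ cong (λ s → shiftSum (x ℤ.^_) m ℤ.+ s) (shiftSum-* x (x ℤ.^_) m) ⟩
  shiftSum (x ℤ.^_) m ℤ.+ x ℤ.* shiftSum (x ℤ.^_) m
    ≡⟨ factor x (shiftSum (x ℤ.^_) m) ⟩
  (1ℤ ℤ.+ x) ℤ.* shiftSum (x ℤ.^_) m
    ≡⟨ cong ((1ℤ ℤ.+ x) ℤ.*_) (shiftSum-^ x m) ⟩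
  (1ℤ ℤ.+ x) ℤ.^ suc m ∎
  where
  open ≡-Reasoning
  factor : ∀ x s → s ℤ.+ x ℤ.* s ≡ (1ℤ ℤ.+ x) ℤ.* s
  factor = solve-∀

-- Alternating sums of binomial coefficients

alternating : ℕ → ℕ → ℤ
alternating j k = -1ℤ ℤ.^ k ℤ.* binom k j

-- The shift changes the sign of (-1)ᵏ, so 1 + E annihilates this sequence.
shiftSum-alternating-0 : ∀ m → shiftSum (alternating 0) (suc m) ≡ 0ℤ
shiftSum-alternating-0 m = begin
  s ℤ.+ shiftSum (alternating 0 ∘ suc) m
    ≡⟨ cong (λ x → s ℤ.+ x) (shiftSum-cong (λ k → ℤ.*-assoc -1ℤ (-1ℤ ℤ.^ k) 1ℤ) m) ⟩
  s ℤ.+ shiftSum (λ k → -1ℤ ℤ.* alternating 0 k) m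
    ≡⟨ cong (λ x → s ℤ.+ x) (shiftSum-* -1ℤ (alternating 0) m) ⟩
  s ℤ.+ -1ℤ ℤ.* s
    ≡⟨ cancel s ⟩
  0ℤ ∎
  where
  open ≡-Reasoning
  s = shiftSum (alternating 0) m
  cancel : ∀ s → s ℤ.+ -1ℤ ℤ.* s ≡ 0ℤ
  cancel = solve-∀

-- By Pascal's rule 1 + E sends `alternating (suc j)` to the negative of `alternating j`, so one
-- factor 1 + E lowers j by one and costs a sign.
shiftSum-alternating-suc : ∀ j m →
  shiftSum (alternating (suc j)) (suc m) ≡ -1ℤ ℤ.* shiftSum (alternating j) m
shiftSum-alternating-suc j m = begin
  s′ ℤ.+ shiftSum (alternating (suc j) ∘ suc) m
    ≡⟨ cong (λ x → s′ ℤ.+ x) (shiftSum-cong (λ k → trans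
         (cong (-1ℤ ℤ.^ suc k ℤ.*_) (pascal k j))
         (expand (-1ℤ ℤ.^ k) (binom k j) (binom k (suc j)))) m) ⟩
  s′ ℤ.+ shiftSum (λ k → -1ℤ ℤ.* (alternating j k ℤ.+ alternating (suc j) k)) m
    ≡⟨ cong (λ x → s′ ℤ.+ x) (trans
         (shiftSum-* -1ℤ (λ k → alternating j k ℤ.+ alternating (suc j) k) m)
         (cong (-1ℤ ℤ.*_) (shiftSum-+ (alternating j) (alternating (suc j)) m))) ⟩
  s′ ℤ.+ -1ℤ ℤ.* (s ℤ.+ s′)
    ≡⟨ cancel s s′ ⟩
  -1ℤ ℤ.* s ∎
  where
  open ≡-Reasoning
  s = shiftSum (alternating j) m
  s′ = shiftSum (alternating (suc j)) m
  expand : ∀ e a b → -1ℤ ℤ.* e ℤ.* (a ℤ.+ b) ≡ -1ℤ ℤ.* (e ℤ.* a ℤ.+ e ℤ.* b)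
  expand = solve-∀
  cancel : ∀ s s′ → s′ ℤ.+ -1ℤ ℤ.* (s ℤ.+ s′) ≡ -1ℤ ℤ.* s
  cancel = solve-∀

shiftSum-alternating-≡ : ∀ m → shiftSum (alternating m) m ≡ -1ℤ ℤ.^ m
shiftSum-alternating-≡ zero    = refl
shiftSum-alternating-≡ (suc m) =
  trans (shiftSum-alternating-suc m m) (cong (-1ℤ ℤ.*_) (shiftSum-alternating-≡ m))

-- Both arguments are lowered together. If m runs out first, C(0,j) with j > 0 is left; if j runs
-- out first, 1 + E meets (-1)ᵏ and kills it.
shiftSum-alternating-≢ : ∀ j m → m ≢ j → shiftSum (alternating j) m ≡ 0ℤ
shiftSum-alternating-≢ zero    zero    0≢0 = contradiction refl 0≢0
shiftSum-alternating-≢ (suc j) zero    _   = refl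
shiftSum-alternating-≢ zero    (suc m) _   = shiftSum-alternating-0 m
shiftSum-alternating-≢ (suc j) (suc m) m≢j =
  trans (shiftSum-alternating-suc j m)
        (cong (-1ℤ ℤ.*_) (shiftSum-alternating-≢ j m (m≢j ∘ cong suc)))

-- Since C(k,l) C(l,j) = C(k,j) C(k∸j,l∸j), this is Vandermonde's convolution.
shiftSum-vandermonde : ∀ j m s k →
  shiftSum (λ l → binom l j ℤ.* binom m (l + s)) k ≡ binom k j ℤ.* binom ((k ∸ j) + m) (k + s)
shiftSum-vandermonde zero    m s zero    = refl
shiftSum-vandermonde (suc j) m s zero    = refl
shiftSum-vandermonde zero    m s (suc k) = begin
  shiftSum (λ l → 1ℤ ℤ.* binom m (l + s)) k ℤ.+ shiftSum (λ l → 1ℤ ℤ.* binom m (suc (l + s))) k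
    ≡⟨ cong₂ ℤ._+_ (shiftSum-vandermonde 0 m s k)
         (trans (shiftSum-cong (λ l → cong (λ i → 1ℤ ℤ.* binom m i) (sym (+-suc l s))) k)
                (shiftSum-vandermonde 0 m (suc s) k)) ⟩
  1ℤ ℤ.* binom (k + m) (k + s) ℤ.+ 1ℤ ℤ.* binom (k + m) (k + suc s)
    ≡⟨ cong (λ i → 1ℤ ℤ.* binom (k + m) (k + s) ℤ.+ 1ℤ ℤ.* binom (k + m) i) (+-suc k s) ⟩
  1ℤ ℤ.* binom (k + m) (k + s) ℤ.+ 1ℤ ℤ.* binom (k + m) (suc (k + s))
    ≡⟨ ℤ.*-distribˡ-+ 1ℤ (binom (k + m) (k + s)) (binom (k + m) (suc (k + s))) ⟨
  1ℤ ℤ.* (binom (k + m) (k + s) ℤ.+ binom (k + m) (suc (k + s)))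
    ≡⟨ cong (1ℤ ℤ.*_) (pascal (k + m) (k + s)) ⟨
  1ℤ ℤ.* binom (suc k + m) (suc k + s) ∎
  where open ≡-Reasoning
shiftSum-vandermonde (suc j) m s (suc k) = begin
  V (suc j) s ℤ.+ shiftSum (λ l → binom (suc l) (suc j) ℤ.* binom m (suc (l + s))) k
    ≡⟨ cong (λ x → V (suc j) s ℤ.+ x) (trans
         (shiftSum-cong (λ l → trans
           (cong₂ (λ x i → x ℤ.* binom m i) (pascal l j) (sym (+-suc l s)))
           (ℤ.*-distribʳ-+ (binom m (l + suc s)) (binom l j) (binom l (suc j)))) k)
         (shiftSum-+ (λ l → binom l j ℤ.* binom m (l + suc s)) _ k)) ⟩
  V (suc j) s ℤ.+ (V j (suc s) ℤ.+ V (suc j) (suc s))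
    ≡⟨ cong₂ ℤ._+_ (shiftSum-vandermonde (suc j) m s k)
         (cong₂ ℤ._+_ (shiftSum-vandermonde j m (suc s) k) (shiftSum-vandermonde (suc j) m (suc s) k)) ⟩
  binom k (suc j) ℤ.* binom (k ∸ suc j + m) (k + s) ℤ.+
    (binom k j ℤ.* binom (k ∸ j + m) (k + suc s) ℤ.+
     binom k (suc j) ℤ.* binom (k ∸ suc j + m) (k + suc s))
    ≡⟨ cong (λ i → binom k (suc j) ℤ.* binom (k ∸ suc j + m) (k + s) ℤ.+
         (binom k j ℤ.* binom (k ∸ j + m) i ℤ.+ binom k (suc j) ℤ.* binom (k ∸ suc j + m) i))
         (+-suc k s) ⟩
  binom k (suc j) ℤ.* binom (k ∸ suc j + m) (k + s) ℤ.+
    (binom k j ℤ.* binom (k ∸ j + m) (suc (k + s)) ℤ.+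
     binom k (suc j) ℤ.* binom (k ∸ suc j + m) (suc (k + s)))
    ≡⟨ collect (binom k (suc j)) (binom k j) (binom (k ∸ suc j + m) (k + s))
         (binom (k ∸ j + m) (suc (k + s))) (binom (k ∸ suc j + m) (suc (k + s))) ⟩
  binom k j ℤ.* binom (k ∸ j + m) (suc (k + s)) ℤ.+
    binom k (suc j) ℤ.* (binom (k ∸ suc j + m) (k + s) ℤ.+ binom (k ∸ suc j + m) (suc (k + s)))
    ≡⟨ cong (λ x → binom k j ℤ.* binom (k ∸ j + m) (suc (k + s)) ℤ.+ x) pascal′ ⟩
  binom k j ℤ.* binom (k ∸ j + m) (suc (k + s)) ℤ.+
    binom k (suc j) ℤ.* binom (k ∸ j + m) (suc (k + s))
    ≡⟨ ℤ.*-distribʳ-+ (binom (k ∸ j + m) (suc (k + s))) (binom k j) (binom k (suc j)) ⟨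
  (binom k j ℤ.+ binom k (suc j)) ℤ.* binom (k ∸ j + m) (suc (k + s))
    ≡⟨ cong (ℤ._* binom (k ∸ j + m) (suc (k + s))) (pascal k j) ⟨
  binom (suc k) (suc j) ℤ.* binom (k ∸ j + m) (suc (k + s)) ∎
  where
  open ≡-Reasoning
  V : ℕ → ℕ → ℤ
  V j s = shiftSum (λ l → binom l j ℤ.* binom m (l + s)) k
  collect : ∀ a b x y z → a ℤ.* x ℤ.+ (b ℤ.* y ℤ.+ a ℤ.* z) ≡ b ℤ.* y ℤ.+ a ℤ.* (x ℤ.+ z)
  collect = solve-∀
  -- With truncated subtraction, k ∸ j is one more than k ∸ suc j only if j < k; otherwise the
  -- factor C(k,j+1) is zero.
  pascal′ : binom k (suc j) ℤ.* (binom (k ∸ suc j + m) (k + s) ℤ.+ binom (k ∸ suc j + m) (suc (k + s)))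
          ≡ binom k (suc j) ℤ.* binom (k ∸ j + m) (suc (k + s))
  pascal′ with suc j ≤? k
  ... | yes j<k = cong (binom k (suc j) ℤ.*_) (trans
    (sym (pascal (k ∸ suc j + m) (k + s)))
    (cong (λ i → binom (i + m) (suc (k + s))) (sym (+-∸-assoc 1 j<k))))
  ... | no  j≮k rewrite k>n⇒nCk≡0 (≰⇒> j≮k) = refl

-- The recurrence for the alternating sums

nCk*k![n∸k]!≡n! : ∀ {n k} → k ≤ n → (n C k) * (k ! * (n ∸ k) !) ≡ n !
nCk*k![n∸k]!≡n! {n} {k} k≤n = trans
  (cong (_* (k ! * (n ∸ k) !)) (nCk≡n!/k![n-k]! k≤n))
  (m/n*n≡m (k![n∸k]!∣n! k≤n))
  where instance _ = k !* (n ∸ k) !≢0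

-- Both products count pairs of disjoint subsets, of sizes k and l, of an N-set. If k + l ≤ N, each
-- becomes N! when multiplied by k! l! (N-k-l)!; if k + l > N, each is zero.
binom-swap : ∀ {N k l} → k ≤ N → l ≤ N →
  binom N k ℤ.* binom (N ∸ k) l ≡ binom N l ℤ.* binom (N ∸ l) k
binom-swap {N} {k} {l} k≤N l≤N with l ≤? N ∸ k
... | no l≰N∸k = begin
  binom N k ℤ.* binom (N ∸ k) l ≡⟨ cong (binom N k ℤ.*_) (binom-< (≰⇒> l≰N∸k)) ⟩
  binom N k ℤ.* 0ℤ              ≡⟨ ℤ.*-zeroʳ (binom N k) ⟩
  0ℤ                            ≡⟨ ℤ.*-zeroʳ (binom N l) ⟨
  binom N l ℤ.* 0ℤ              ≡⟨ cong (binom N l ℤ.*_) (binom-< (≰⇒> k≰N∸l)) ⟨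
  binom N l ℤ.* binom (N ∸ l) k ∎
  where
  open ≡-Reasoning
  k≰N∸l : ¬ k ≤ N ∸ l
  k≰N∸l k≤N∸l = l≰N∸k (m+n≤o⇒m≤o∸n l (subst (_≤ N) (+-comm k l) (m≤o∸n⇒m+n≤o k l≤N k≤N∸l)))
... | yes l≤N∸k = begin
  binom N k ℤ.* binom (N ∸ k) l   ≡⟨ ℤ.pos-* (N C k) ((N ∸ k) C l) ⟨
  + ((N C k) * ((N ∸ k) C l))     ≡⟨ cong +_ (*-cancelʳ-≡ _ _ (k ! * (l ! * (N ∸ k ∸ l) !)) balanced) ⟩
  + ((N C l) * ((N ∸ l) C k))     ≡⟨ ℤ.pos-* (N C l) ((N ∸ l) C k) ⟩
  binom N l ℤ.* binom (N ∸ l) k   ∎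
  where
  open ≡-Reasoning
  instance _ = m*n≢0 (k !) (l ! * (N ∸ k ∸ l) !) {{k !≢0}} {{l !* (N ∸ k ∸ l) !≢0}}
  regroup : ∀ x y a b → x * y * (a * b) ≡ x * (a * (y * b))
  regroup = ℕ-solve-∀
  multinomial : ∀ {i j} → i ≤ N → j ≤ N ∸ i →
    (N C i) * ((N ∸ i) C j) * (i ! * (j ! * (N ∸ i ∸ j) !)) ≡ N !
  multinomial {i} {j} i≤N j≤N∸i = begin
    (N C i) * ((N ∸ i) C j) * (i ! * (j ! * (N ∸ i ∸ j) !))
      ≡⟨ regroup (N C i) ((N ∸ i) C j) (i !) (j ! * (N ∸ i ∸ j) !) ⟩
    (N C i) * (i ! * (((N ∸ i) C j) * (j ! * (N ∸ i ∸ j) !)))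
      ≡⟨ cong (λ x → (N C i) * (i ! * x)) (nCk*k![n∸k]!≡n! j≤N∸i) ⟩
    (N C i) * (i ! * (N ∸ i) !)
      ≡⟨ nCk*k![n∸k]!≡n! i≤N ⟩
    N ! ∎
  k≤N∸l : k ≤ N ∸ l
  k≤N∸l = m+n≤o⇒m≤o∸n k (subst (_≤ N) (+-comm l k) (m≤o∸n⇒m+n≤o l k≤N l≤N∸k))
  N∸k∸l≡N∸l∸k : N ∸ k ∸ l ≡ N ∸ l ∸ k
  N∸k∸l≡N∸l∸k = begin
    N ∸ k ∸ l   ≡⟨ ∸-+-assoc N k l ⟩
    N ∸ (k + l) ≡⟨ cong (N ∸_) (+-comm k l) ⟩
    N ∸ (l + k) ≡⟨ ∸-+-assoc N l k ⟨
    N ∸ l ∸ k   ∎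
  balanced : (N C k) * ((N ∸ k) C l) * (k ! * (l ! * (N ∸ k ∸ l) !)) ≡
          (N C l) * ((N ∸ l) C k) * (k ! * (l ! * (N ∸ k ∸ l) !))
  balanced = begin
    (N C k) * ((N ∸ k) C l) * (k ! * (l ! * (N ∸ k ∸ l) !))
      ≡⟨ multinomial k≤N l≤N∸k ⟩
    N !
      ≡⟨ multinomial l≤N k≤N∸l ⟨
    (N C l) * ((N ∸ l) C k) * (l ! * (k ! * (N ∸ l ∸ k) !))
      ≡⟨ cong (λ x → (N C l) * ((N ∸ l) C k) * x) (ℕ*.x∙yz≈y∙xz (l !) (k !) ((N ∸ l ∸ k) !)) ⟩
    (N C l) * ((N ∸ l) C k) * (k ! * (l ! * (N ∸ l ∸ k) !))
      ≡⟨ cong (λ x → (N C l) * ((N ∸ l) C k) * (k ! * (l ! * x !))) N∸k∸l≡N∸l∸k ⟨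
    (N C l) * ((N ∸ l) C k) * (k ! * (l ! * (N ∸ k ∸ l) !)) ∎

-- Multiplication by C(N,k) turns such a weight into a linear combination of such weights, with
-- coefficients free of k; this makes a recurrence in the exponent possible. The weight for l = 0 is
-- 1, which gives the sum of the theorem.
kernel : ℕ → ℕ → ℕ → ℤ
kernel N l k = binom k l ℤ.* binom (N ∸ k) l

-- `binom-swap` trades the factor C(N,k) for C(N,j), which does not depend on k; the remaining
-- product is expanded in kernels by `∑-kernel`.
binom-*-kernel : ∀ {N j k} → j ≤ N → k ≤ N →
  binom N k ℤ.* kernel N j k ≡ binom N j ℤ.* (binom k j ℤ.* binom (N ∸ j) k)
binom-*-kernel {N} {j} {k} j≤N k≤N = begin
  binom N k ℤ.* (binom k j ℤ.* binom (N ∸ k) j) ≡⟨ x∙yz≈y∙xz (binom N k) (binom k j) (binom (N ∸ k) j) ⟩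
  binom k j ℤ.* (binom N k ℤ.* binom (N ∸ k) j) ≡⟨ cong (binom k j ℤ.*_) (binom-swap k≤N j≤N) ⟩
  binom k j ℤ.* (binom N j ℤ.* binom (N ∸ j) k) ≡⟨ x∙yz≈y∙xz (binom k j) (binom N j) (binom (N ∸ j) k) ⟩
  binom N j ℤ.* (binom k j ℤ.* binom (N ∸ j) k) ∎
  where
  open ≡-Reasoning

-- Vandermonde with m = N ∸ k and offset 0. If j ≤ k, the upper index (k-j) + (N-k) collapses to
-- N-j; otherwise C(k,j) is zero.
∑-kernel : ∀ {N k} j → k ≤ N →
  ∑[ l < suc N ] (binom (toℕ l) j ℤ.* kernel N (toℕ l) k) ≡ binom k j ℤ.* binom (N ∸ j) k
∑-kernel {N} {k} j k≤N = begin
  ∑[ l < suc N ] (binom (toℕ l) j ℤ.* kernel N (toℕ l) k)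
    ≡⟨ sum-cong-≗ {suc N} (λ l → trans
         (x∙yz≈y∙xz (binom (toℕ l) j) (binom k (toℕ l)) (binom (N ∸ k) (toℕ l)))
         (cong (λ i → binom k (toℕ l) ℤ.* (binom (toℕ l) j ℤ.* binom (N ∸ k) i))
           (sym (+-identityʳ (toℕ l))))) ⟩
  ∑[ l < suc N ] (binom k (toℕ l) ℤ.* (binom (toℕ l) j ℤ.* binom (N ∸ k) (toℕ l + 0)))
    ≡⟨ binomialSum (λ l → binom l j ℤ.* binom (N ∸ k) (l + 0)) (s≤s k≤N) ⟩
  shiftSum (λ l → binom l j ℤ.* binom (N ∸ k) (l + 0)) k
    ≡⟨ shiftSum-vandermonde j (N ∸ k) 0 k ⟩
  binom k j ℤ.* binom ((k ∸ j) + (N ∸ k)) (k + 0)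
    ≡⟨ cong (λ i → binom k j ℤ.* binom ((k ∸ j) + (N ∸ k)) i) (+-identityʳ k) ⟩
  binom k j ℤ.* binom ((k ∸ j) + (N ∸ k)) k
    ≡⟨ cancel ⟩
  binom k j ℤ.* binom (N ∸ j) k ∎
  where
  open ≡-Reasoning
  cancel : binom k j ℤ.* binom ((k ∸ j) + (N ∸ k)) k ≡ binom k j ℤ.* binom (N ∸ j) k
  cancel with j ≤? k
  ... | no  j≰k rewrite k>n⇒nCk≡0 (≰⇒> j≰k) = refl
  ... | yes j≤k = cong (λ i → binom k j ℤ.* binom i k) (begin
    (k ∸ j) + (N ∸ k) ≡⟨ +-comm (k ∸ j) (N ∸ k) ⟩
    (N ∸ k) + (k ∸ j) ≡⟨ +-∸-assoc (N ∸ k) j≤k ⟨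
    (N ∸ k) + k ∸ j   ≡⟨ cong (_∸ j) (m∸n+n≡m k≤N) ⟩
    N ∸ j             ∎)

moment : ℕ → ℕ → ℕ → ℤ
moment N j t = ∑[ k < suc N ] (-1ℤ ℤ.^ toℕ k ℤ.* (binom N (toℕ k) ℤ.^ t ℤ.* kernel N j (toℕ k)))

-- A linear operator whose matrix is upper triangular with diagonal entries C(N,j). It drives both
-- `moment` and `orbit`.
step : ℕ → (ℕ → ℤ) → ℕ → ℤ
step N x j = binom N j ℤ.* ∑[ l < suc N ] (binom (toℕ l) j ℤ.* x (toℕ l))

step-cong : ∀ {N x y} → (∀ {l} → l ≤ N → x l ≡ y l) → ∀ j → step N x j ≡ step N y j
step-cong {N} x≡y j = cong (binom N j ℤ.*_)
  (sum-cong-≗ {suc N} λ l → cong (binom (toℕ l) j ℤ.*_) (x≡y (≤-pred (toℕ<n l))))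

step-* : ∀ N c x j → step N (λ l → c ℤ.* x l) j ≡ c ℤ.* step N x j
step-* N c x j = begin
  b ℤ.* ∑[ l < suc N ] (binom (toℕ l) j ℤ.* (c ℤ.* x (toℕ l)))
    ≡⟨ cong (b ℤ.*_) (sum-cong-≗ {suc N} λ l → x∙yz≈y∙xz (binom (toℕ l) j) c (x (toℕ l))) ⟩
  b ℤ.* ∑[ l < suc N ] (c ℤ.* (binom (toℕ l) j ℤ.* x (toℕ l)))
    ≡⟨ cong (b ℤ.*_) (*-distribˡ-sum {suc N} c (λ l → binom (toℕ l) j ℤ.* x (toℕ l))) ⟨
  b ℤ.* (c ℤ.* ∑[ l < suc N ] (binom (toℕ l) j ℤ.* x (toℕ l)))
    ≡⟨ x∙yz≈y∙xz b c (∑[ l < suc N ] (binom (toℕ l) j ℤ.* x (toℕ l))) ⟩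
  c ℤ.* step N x j ∎
  where
  open ≡-Reasoning
  b = binom N j

-- One of the t + 1 factors C(N,k) is absorbed into the kernel, which becomes a combination of
-- kernels; exchanging the sums over k and l leaves moments of order t.
moment-suc : ∀ {N j} t → j ≤ N → moment N j (suc t) ≡ step N (λ l → moment N l t) j
moment-suc {N} {j} t j≤N = begin
  ∑[ k < suc N ] (σ k ℤ.* (b k ℤ.* b k ℤ.^ t ℤ.* kernel N j (toℕ k)))
    ≡⟨ sum-cong-≗ {suc N} expand ⟩
  ∑[ k < suc N ] (binom N j ℤ.* ∑[ l < suc N ] F l k)
    ≡⟨ *-distribˡ-sum {suc N} (binom N j) (λ k → ∑[ l < suc N ] F l k) ⟨
  binom N j ℤ.* ∑[ k < suc N ] ∑[ l < suc N ] F l k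
    ≡⟨ cong (binom N j ℤ.*_) (∑-comm {suc N} {suc N} (λ k l → F l k)) ⟩
  binom N j ℤ.* ∑[ l < suc N ] ∑[ k < suc N ] F l k
    ≡⟨ cong (binom N j ℤ.*_) (sum-cong-≗ {suc N} λ l →
         *-distribˡ-sum {suc N} (binom (toℕ l) j) (λ k → σ k ℤ.* (b k ℤ.^ t ℤ.* kernel N (toℕ l) (toℕ k)))) ⟨
  step N (λ l → moment N l t) j ∎
  where
  open ≡-Reasoning
  σ b : Fin (suc N) → ℤ
  σ k = -1ℤ ℤ.^ toℕ k
  b k = binom N (toℕ k)
  F : Fin (suc N) → Fin (suc N) → ℤ
  F l k = binom (toℕ l) j ℤ.* (σ k ℤ.* (b k ℤ.^ t ℤ.* kernel N (toℕ l) (toℕ k)))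
  regroup₁ : ∀ s c x p → s ℤ.* (c ℤ.* x ℤ.* p) ≡ s ℤ.* x ℤ.* (c ℤ.* p)
  regroup₁ = solve-∀
  regroup₂ : ∀ s x c p → s ℤ.* x ℤ.* (c ℤ.* p) ≡ c ℤ.* (s ℤ.* (x ℤ.* p))
  regroup₂ = solve-∀
  expand : ∀ k → σ k ℤ.* (b k ℤ.* b k ℤ.^ t ℤ.* kernel N j (toℕ k)) ≡ binom N j ℤ.* ∑[ l < suc N ] F l k
  expand k = begin
    σ k ℤ.* (b k ℤ.* b k ℤ.^ t ℤ.* kernel N j (toℕ k))
      ≡⟨ regroup₁ (σ k) (b k) (b k ℤ.^ t) (kernel N j (toℕ k)) ⟩
    σ k ℤ.* b k ℤ.^ t ℤ.* (b k ℤ.* kernel N j (toℕ k))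
      ≡⟨ cong (σ k ℤ.* b k ℤ.^ t ℤ.*_) (trans (binom-*-kernel j≤N k≤N)
           (cong (binom N j ℤ.*_) (sym (∑-kernel j k≤N)))) ⟩
    σ k ℤ.* b k ℤ.^ t ℤ.* (binom N j ℤ.* ∑[ l < suc N ] (binom (toℕ l) j ℤ.* kernel N (toℕ l) (toℕ k)))
      ≡⟨ x∙yz≈y∙xz (σ k ℤ.* b k ℤ.^ t) (binom N j) _ ⟩
    binom N j ℤ.* (σ k ℤ.* b k ℤ.^ t ℤ.* ∑[ l < suc N ] (binom (toℕ l) j ℤ.* kernel N (toℕ l) (toℕ k)))
      ≡⟨ cong (binom N j ℤ.*_) (trans
           (*-distribˡ-sum {suc N} (σ k ℤ.* b k ℤ.^ t) (λ l → binom (toℕ l) j ℤ.* kernel N (toℕ l) (toℕ k)))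
           (sum-cong-≗ {suc N} λ l → regroup₂ (σ k) (b k ℤ.^ t) (binom (toℕ l) j) (kernel N (toℕ l) (toℕ k)))) ⟩
    binom N j ℤ.* ∑[ l < suc N ] F l k ∎
    where
    k≤N : toℕ k ≤ N
    k≤N = ≤-pred (toℕ<n k)

-- Once the single factor C(N,k) is absorbed no power is left, and an alternating sum along row N-j
-- remains.
moment-1 : ∀ {N j} → j ≤ N → moment N j 1 ≡ binom N j ℤ.* shiftSum (alternating j) (N ∸ j)
moment-1 {N} {j} j≤N = begin
  ∑[ k < suc N ] (-1ℤ ℤ.^ toℕ k ℤ.* (binom N (toℕ k) ℤ.* 1ℤ ℤ.* kernel N j (toℕ k)))
    ≡⟨ sum-cong-≗ {suc N} (λ k → trans
         (cong (λ x → -1ℤ ℤ.^ toℕ k ℤ.* x) (trans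
           (cong (ℤ._* kernel N j (toℕ k)) (ℤ.*-identityʳ (binom N (toℕ k))))
           (binom-*-kernel j≤N (≤-pred (toℕ<n k)))))
         (regroup (-1ℤ ℤ.^ toℕ k) (binom N j) (binom (toℕ k) j) (binom (N ∸ j) (toℕ k)))) ⟩
  ∑[ k < suc N ] (binom N j ℤ.* (binom (N ∸ j) (toℕ k) ℤ.* alternating j (toℕ k)))
    ≡⟨ *-distribˡ-sum {suc N} (binom N j) (λ k → binom (N ∸ j) (toℕ k) ℤ.* alternating j (toℕ k)) ⟨
  binom N j ℤ.* ∑[ k < suc N ] (binom (N ∸ j) (toℕ k) ℤ.* alternating j (toℕ k))
    ≡⟨ cong (binom N j ℤ.*_) (binomialSum (alternating j) (s≤s (m∸n≤m N j))) ⟩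
  binom N j ℤ.* shiftSum (alternating j) (N ∸ j) ∎
  where
  open ≡-Reasoning
  regroup : ∀ e a b c → e ℤ.* (a ℤ.* (b ℤ.* c)) ≡ a ℤ.* (c ℤ.* (e ℤ.* b))
  regroup = solve-∀

-- For N = 2n and j ≤ N this is the moment of order t + 1 divided by M, obtained without division:
-- the start is (-1)ⁿ at j = n and 0 elsewhere.
orbit : ℕ → ℕ → ℕ → ℤ
orbit N zero    j = shiftSum (alternating j) (N ∸ j)
orbit N (suc t)   = step N (orbit N t)

orbit-0-≢ : ∀ {n j} → j ≤ 2 * n → j ≢ n → orbit (2 * n) 0 j ≡ 0ℤ
orbit-0-≢ {n} {j} j≤2n j≢n = shiftSum-alternating-≢ j (2 * n ∸ j) λ eq →
  j≢n (*-cancelˡ-≡ j n 2 (begin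
    j + (j + 0)     ≡⟨ cong (λ x → j + x) (+-identityʳ j) ⟩
    j + j           ≡⟨ cong (λ x → j + x) eq ⟨
    j + (2 * n ∸ j) ≡⟨ m+[n∸m]≡n j≤2n ⟩
    2 * n           ∎))
  where open ≡-Reasoning

orbit-0-≡ : ∀ n → orbit (2 * n) 0 n ≡ -1ℤ ℤ.^ n
orbit-0-≡ n = trans
  (cong (shiftSum (alternating n)) (trans (m+n∸m≡n n (n + 0)) (+-identityʳ n)))
  (shiftSum-alternating-≡ n)

n≤2n : ∀ n → n ≤ 2 * n
n≤2n n = m≤m+n n (n + 0)

-- For t = 0 and j = n the factor C(2n,j) of `moment-1` is M itself, and for j ≠ n both sides are
-- zero. Linearity of `step` then carries the factor M along.
moment-orbit : ∀ n t {j} → j ≤ 2 * n →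
  moment (2 * n) j (suc t) ≡ binom (2 * n) n ℤ.* orbit (2 * n) t j
moment-orbit n zero {j} j≤2n with j ≟ n
... | yes refl = moment-1 j≤2n
... | no  j≢n  = begin
  moment (2 * n) j 1                        ≡⟨ moment-1 j≤2n ⟩
  binom (2 * n) j ℤ.* orbit (2 * n) 0 j     ≡⟨ cong (binom (2 * n) j ℤ.*_) (orbit-0-≢ j≤2n j≢n) ⟩
  binom (2 * n) j ℤ.* 0ℤ                    ≡⟨ ℤ.*-zeroʳ (binom (2 * n) j) ⟩
  0ℤ                                        ≡⟨ ℤ.*-zeroʳ (binom (2 * n) n) ⟨
  binom (2 * n) n ℤ.* 0ℤ                    ≡⟨ cong (binom (2 * n) n ℤ.*_) (orbit-0-≢ j≤2n j≢n) ⟨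
  binom (2 * n) n ℤ.* orbit (2 * n) 0 j     ∎
  where open ≡-Reasoning
moment-orbit n (suc t) {j} j≤2n = begin
  moment (2 * n) j (suc (suc t))
    ≡⟨ moment-suc (suc t) j≤2n ⟩
  step (2 * n) (λ l → moment (2 * n) l (suc t)) j
    ≡⟨ step-cong (moment-orbit n t) j ⟩
  step (2 * n) (λ l → binom (2 * n) n ℤ.* orbit (2 * n) t l) j
    ≡⟨ step-* (2 * n) (binom (2 * n) n) (orbit (2 * n) t) j ⟩
  binom (2 * n) n ℤ.* orbit (2 * n) (suc t) j ∎
  where open ≡-Reasoning

-- The step into j = 0 has all coefficients 1, so it adds up the start vector, whose only nonzero
-- entry is at l = n.
orbit-1 : ∀ n → orbit (2 * n) 1 0 ≡ -1ℤ ℤ.^ n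
orbit-1 n = begin
  1ℤ ℤ.* ∑[ l < suc (2 * n) ] term l
    ≡⟨ ℤ.*-identityˡ _ ⟩
  ∑[ l < suc (2 * n) ] term l
    ≡⟨ sum-remove {2 * n} {i} term ⟩
  term i ℤ.+ sum (λ l → term (punchIn i l))
    ≡⟨ cong₂ ℤ._+_ (trans (ℤ.*-identityˡ _) (trans (cong (orbit (2 * n) 0) toℕ-i) (orbit-0-≡ n)))
         (∑-zero {2 * n} λ l → trans (ℤ.*-identityˡ _)
           (orbit-0-≢ {n} (≤-pred (toℕ<n (punchIn i l))) λ eq →
             punchInᵢ≢i i l (toℕ-injective (trans eq (sym toℕ-i))))) ⟩
  -1ℤ ℤ.^ n ℤ.+ 0ℤ
    ≡⟨ ℤ.+-identityʳ (-1ℤ ℤ.^ n) ⟩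
  -1ℤ ℤ.^ n ∎
  where
  open ≡-Reasoning
  i : Fin (suc (2 * n))
  i = fromℕ< (s≤s (n≤2n n))
  toℕ-i : toℕ i ≡ n
  toℕ-i = toℕ-fromℕ< (s≤s (n≤2n n))
  term : Fin (suc (2 * n)) → ℤ
  term l = binom (toℕ l) 0 ℤ.* orbit (2 * n) 0 (toℕ l)

pos-^ : ∀ m k → + (m ^ k) ≡ (+ m) ℤ.^ k
pos-^ m zero    = refl
pos-^ m (suc k) = trans (ℤ.pos-* m (m ^ k)) (cong (+ m ℤ.*_) (pos-^ m k))

alternatingPowerSum-moment : ∀ n r → alternatingPowerSum n r ≡ moment (2 * n) 0 r
alternatingPowerSum-moment n r = sum-cong-≗ {suc (2 * n)} λ k →
  cong (-1ℤ ℤ.^ toℕ k ℤ.*_) (trans (pos-^ ((2 * n) C toℕ k) r) (sym (ℤ.*-identityʳ _)))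

alternatingPowerSum-orbit : ∀ n t →
  alternatingPowerSum n (suc t) ≡ binom (2 * n) n ℤ.* orbit (2 * n) t 0
alternatingPowerSum-orbit n t = trans (alternatingPowerSum-moment n (suc t)) (moment-orbit n t z≤n)

-- Powers modulo prime powers

prime∤1 : ∀ {p} → Prime p → ¬ p ∣ 1
prime∤1 pr p∣1 = ¬prime[1] (subst Prime (∣1⇒≡1 p∣1) pr)

prime∣!⇒≤ : ∀ {p} → Prime p → ∀ k → p ∣ k ! → p ≤ k
prime∣!⇒≤ pr zero    p∣1 = contradiction p∣1 (prime∤1 pr)
prime∣!⇒≤ pr (suc k) p∣k! with euclidsLemma (suc k) (k !) pr p∣k!
... | inj₁ p∣1+k = ∣⇒≤ p∣1+k
... | inj₂ p∣k!  = m≤n⇒m≤1+n (prime∣!⇒≤ pr k p∣k!)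

-- p divides p! = C(p,k) k! (p-k)!, but neither factorial, as k and p-k are less than p.
prime∣binomial : ∀ {p k} → Prime p → 0 < k → k < p → p ∣ (p C k)
prime∣binomial {p@(suc p-1)} {k@(suc k-1)} pr 0<k k<p
  with euclidsLemma (p C k) (k ! * (p ∸ k) !) pr
         (subst (p ∣_) (sym (nCk*k![n∸k]!≡n! (<⇒≤ k<p))) (m∣m*n (p-1 !)))
... | inj₁ p∣pCk = p∣pCk
... | inj₂ p∣k![p∸k]! with euclidsLemma (k !) ((p ∸ k) !) pr p∣k![p∸k]!
...   | inj₁ p∣k!     = contradiction (prime∣!⇒≤ pr k p∣k!) (<⇒≱ k<p)
...   | inj₂ p∣[p∸k]! = contradiction (prime∣!⇒≤ pr (p ∸ k) p∣[p∸k]!) (<⇒≱ (s≤s (m∸n≤m p-1 k-1)))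
prime∣binomial {zero} pr _ _ = contradiction pr ¬prime[0]

[1+x]^p≈1+x^p : ∀ {p} → Prime p → ∀ x → (1ℤ ℤ.+ x) ℤ.^ p ≈ 1ℤ ℤ.+ x ℤ.^ p mod p
[1+x]^p≈1+x^p {zero}      pr x = contradiction pr ¬prime[0]
[1+x]^p≈1+x^p {p@(suc q)} pr x = begin
  (1ℤ ℤ.+ x) ℤ.^ p
    ≡⟨ shiftSum-^ x p ⟨
  shiftSum (x ℤ.^_) p
    ≡⟨ binomialSum (x ℤ.^_) (n<1+n p) ⟨
  1ℤ ℤ.+ ∑[ k < p ] term (suc (toℕ k))
    -- Only the outer terms k = 0 and k = p survive modulo p, so the last one is split off too.
    ≡⟨ cong (λ y → 1ℤ ℤ.+ y) (sum-init-last {q} (λ k → term (suc (toℕ k)))) ⟩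
  1ℤ ℤ.+ (∑[ k < q ] term (suc (toℕ (inject₁ k))) ℤ.+ term (suc (toℕ (fromℕ q))))
    ≈⟨ +-cong-≈ (≈-refl {a = 1ℤ}) (+-cong-≈ (sum-cong-≈ {n = q} vanish) (≈-reflexive last-term)) ⟩
  1ℤ ℤ.+ (∑[ k < q ] 0ℤ ℤ.+ x ℤ.^ p)
    ≡⟨ cong (λ y → 1ℤ ℤ.+ y) (trans (cong (λ y → y ℤ.+ x ℤ.^ p) (sum-replicate-zero q)) (ℤ.+-identityˡ (x ℤ.^ p))) ⟩
  1ℤ ℤ.+ x ℤ.^ p ∎
  where
  open ≈-Reasoning p
  term : ℕ → ℤ
  term k = binom p k ℤ.* x ℤ.^ k
  vanish : ∀ (k : Fin q) → term (suc (toℕ (inject₁ k))) ≈ 0ℤ mod p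
  vanish k rewrite toℕ-inject₁ k = *-cong-≈ {a = binom p (suc (toℕ k))} {b = 0ℤ} {c = x ℤ.^ suc (toℕ k)}
    (∣⇒≈0 (prime∣binomial pr z<s (s≤s (toℕ<n k)))) ≈-refl
  last-term : term (suc (toℕ (fromℕ q))) ≡ x ℤ.^ p
  last-term rewrite toℕ-fromℕ q | nCn≡1 p = ℤ.*-identityˡ (x ℤ.^ p)

c^p≈c : ∀ {p} → Prime p → ∀ c → (+ c) ℤ.^ p ≈ + c mod p
c^p≈c {zero}  pr c       = contradiction pr ¬prime[0]
c^p≈c {suc q} pr zero    = ≈-refl
c^p≈c {suc q} pr (suc c) = ≈-trans ([1+x]^p≈1+x^p pr (+ c)) (+-cong-≈ (≈-refl {a = 1ℤ}) (c^p≈c pr c))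

-- Fermat's little theorem: p divides c^p - c = c (c^(p-1) - 1), and it cannot divide the first
-- factor.
c^[p-1]≈1 : ∀ {p} → Prime p → ∀ {c} → ¬ p ∣ c → (+ c) ℤ.^ pred p ≈ 1ℤ mod p
c^[p-1]≈1 {zero}  pr     p∤c = contradiction pr ¬prime[0]
c^[p-1]≈1 {suc q} pr {c} p∤c
  with euclidsLemma c ∣ (+ c) ℤ.^ q ℤ.- 1ℤ ∣ pr
         (subst (suc q ∣_) (ℤ.abs-* (+ c) ((+ c) ℤ.^ q ℤ.- 1ℤ))
           (ℤ.∣⇒∣ᵤ (subst (+ suc q ℤ.∣_) (factor (+ c) ((+ c) ℤ.^ q)) (difference (c^p≈c pr c)))))
  where
  factor : ∀ c y → c ℤ.* y ℤ.- c ≡ c ℤ.* (y ℤ.- 1ℤ)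
  factor = solve-∀
... | inj₁ p∣c = contradiction p∣c p∤c
... | inj₂ d   = congruent (ℤ.∣ᵤ⇒∣ d)

-- The sum 1 + x + ... + x^(m-1) in Horner form.
geometric : ℤ → ℕ → ℤ
geometric x zero    = 0ℤ
geometric x (suc m) = 1ℤ ℤ.+ x ℤ.* geometric x m

x^m-1 : ∀ x m → x ℤ.^ m ℤ.- 1ℤ ≡ (x ℤ.- 1ℤ) ℤ.* geometric x m
x^m-1 x zero    = sym (ℤ.*-zeroʳ (x ℤ.- 1ℤ))
x^m-1 x (suc m) = begin
  x ℤ.* x ℤ.^ m ℤ.- 1ℤ                                        ≡⟨ split x (x ℤ.^ m) ⟩
  x ℤ.* (x ℤ.^ m ℤ.- 1ℤ) ℤ.+ (x ℤ.- 1ℤ)                       ≡⟨ cong (λ y → x ℤ.* y ℤ.+ (x ℤ.- 1ℤ)) (x^m-1 x m) ⟩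
  x ℤ.* ((x ℤ.- 1ℤ) ℤ.* geometric x m) ℤ.+ (x ℤ.- 1ℤ)         ≡⟨ collect x (geometric x m) ⟩
  (x ℤ.- 1ℤ) ℤ.* geometric x (suc m)                          ∎
  where
  open ≡-Reasoning
  split : ∀ x y → x ℤ.* y ℤ.- 1ℤ ≡ x ℤ.* (y ℤ.- 1ℤ) ℤ.+ (x ℤ.- 1ℤ)
  split = solve-∀
  collect : ∀ x g → x ℤ.* ((x ℤ.- 1ℤ) ℤ.* g) ℤ.+ (x ℤ.- 1ℤ) ≡ (x ℤ.- 1ℤ) ℤ.* (1ℤ ℤ.+ x ℤ.* g)
  collect = solve-∀

geometric≈m : ∀ {d x} → x ≈ 1ℤ mod d → ∀ m → geometric x m ≈ + m mod d
geometric≈m x≈1 zero    = ≈-refl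
geometric≈m {d} {x} x≈1 (suc m) = +-cong-≈ (≈-refl {a = 1ℤ})
  (≈-trans (*-cong-≈ x≈1 (geometric≈m x≈1 m)) (≈-reflexive (ℤ.*-identityˡ (+ m))))

≈-∣ : ∀ {d m a b} → d ∣ m → a ≈ b mod m → a ≈ b mod d
≈-∣ d∣m (congruent e) = congruent (ℤ.∣-trans (ℤ.∣ᵤ⇒∣ d∣m) e)

-- In x^p - 1 = (x - 1)(1 + x + ... + x^(p-1)) the second factor is a sum of p terms congruent to 1
-- modulo p, so it contributes one more factor p.
x^p≈1 : ∀ p i {x} → x ≈ 1ℤ mod p ^ suc i → x ℤ.^ p ≈ 1ℤ mod p ^ suc (suc i)
x^p≈1 p i {x} x≈1 = congruent (subst₂ ℤ._∣_ (sym (ℤ.pos-* p (p ^ suc i))) (sym (x^m-1 x p)) divisible)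
  where
  p∣geometric : + p ℤ.∣ geometric x p
  p∣geometric = ℤ.∣ᵤ⇒∣ (≈0⇒∣ (≈-trans (geometric≈m (≈-∣ (m∣m*n (p ^ i)) x≈1) p) (∣⇒≈0 ∣-refl)))
  divisible : + p ℤ.* + (p ^ suc i) ℤ.∣ (x ℤ.- 1ℤ) ℤ.* geometric x p
  divisible = ℤ.∣-trans (ℤ.*-monoˡ-∣ (+ (p ^ suc i)) p∣geometric)
    (subst (ℤ._∣ (x ℤ.- 1ℤ) ℤ.* geometric x p) (ℤ.*-comm (+ (p ^ suc i)) (geometric x p))
      (ℤ.*-monoˡ-∣ (geometric x p) (difference x≈1)))

x^[p^a]≈1 : ∀ p a {x} → x ≈ 1ℤ mod p → x ℤ.^ (p ^ a) ≈ 1ℤ mod p ^ suc a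
x^[p^a]≈1 p zero {x} x≈1 = subst (x ℤ.^ 1 ≈ 1ℤ mod_) (sym (*-identityʳ p))
  (≈-trans (≈-reflexive (ℤ.^-identityʳ x)) x≈1)
x^[p^a]≈1 p (suc a) {x} x≈1 =
  ≈-trans (≈-reflexive (trans (cong (x ℤ.^_) (*-comm p (p ^ a))) (sym (ℤ.^-*-assoc x (p ^ a) p))))
          (x^p≈1 p a (x^[p^a]≈1 p a x≈1))

x^k≈1 : ∀ {d m k x} → x ℤ.^ m ≈ 1ℤ mod d → m ∣ k → x ℤ.^ k ≈ 1ℤ mod d
x^k≈1 {d} {m} {_} {x} x^m≈1 (divides-refl q) = begin
  x ℤ.^ (q * m)    ≡⟨ cong (x ℤ.^_) (*-comm q m) ⟩
  x ℤ.^ (m * q)    ≡⟨ ℤ.^-*-assoc x m q ⟨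
  (x ℤ.^ m) ℤ.^ q  ≈⟨ ^-cong-≈ q x^m≈1 ⟩
  1ℤ ℤ.^ q         ≡⟨ ℤ.^-zeroˡ q ⟩
  1ℤ               ∎
  where open ≈-Reasoning d

-- Euler's theorem for the modulus p^(a+1): Fermat's congruence is lifted a times by p-th powers.
c^k≈1 : ∀ {p} → Prime p → ∀ a {c k} → ¬ p ∣ c → pred p * p ^ a ∣ k → (+ c) ℤ.^ k ≈ 1ℤ mod p ^ suc a
c^k≈1 {p} pr a {c} p∤c = x^k≈1
  (≈-trans (≈-reflexive (sym (ℤ.^-*-assoc (+ c) (pred p) (p ^ a))))
           (x^[p^a]≈1 p a (c^[p-1]≈1 pr p∤c)))

-- The totient of a multiple of p

-- Sums over the list that `φ` filters, so that counting becomes addition of indicator functions.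
tally : (ℕ → ℕ) → ℕ → ℕ
tally f n = sumᴸ (applyUpTo f n)

tally-cong : ∀ {f g} → (∀ k → f k ≡ g k) → ∀ n → tally f n ≡ tally g n
tally-cong f≡g zero    = refl
tally-cong f≡g (suc n) = cong₂ _+_ (f≡g 0) (tally-cong (f≡g ∘ suc) n)

tally-zero : ∀ {f} n → (∀ {k} → k < n → f k ≡ 0) → tally f n ≡ 0
tally-zero zero    f≡0 = refl
tally-zero (suc n) f≡0 = cong₂ _+_ (f≡0 z<s) (tally-zero n (f≡0 ∘ s≤s))

tally-distrib-+ : ∀ f g n → tally (λ k → f k + g k) n ≡ tally f n + tally g n
tally-distrib-+ f g zero    = refl
tally-distrib-+ f g (suc n) = trans
  (cong (λ x → f 0 + g 0 + x) (tally-distrib-+ (f ∘ suc) (g ∘ suc) n))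
  (ℕ+.interchange (f 0) (g 0) (tally (f ∘ suc) n) (tally (g ∘ suc) n))

tally-++ : ∀ f m n → tally f (m + n) ≡ tally f m + tally (λ k → f (m + k)) n
tally-++ f zero    n = refl
tally-++ f (suc m) n = trans
  (cong (λ x → f 0 + x) (tally-++ (f ∘ suc) m n))
  (sym (+-assoc (f 0) (tally (f ∘ suc) m) _))

tally-suc : ∀ f n → tally f (suc n) ≡ tally f n + f n
tally-suc f n = begin
  tally f (1 + n)                           ≡⟨ cong (tally f) (+-comm 1 n) ⟩
  tally f (n + 1)                           ≡⟨ tally-++ f n 1 ⟩
  tally f n + (f (n + 0) + 0)               ≡⟨ cong (λ x → tally f n + x) (+-identityʳ _) ⟩
  tally f n + f (n + 0)                     ≡⟨ cong (λ i → tally f n + f i) (+-identityʳ n) ⟩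
  tally f n + f n                           ∎
  where open ≡-Reasoning

tally-periodic : ∀ {f} m → (∀ k → f (m + k) ≡ f k) → ∀ q → tally f (q * m) ≡ q * tally f m
tally-periodic {f} m periodic zero    = refl
tally-periodic {f} m periodic (suc q) = trans (tally-++ f m (q * m))
  (cong (λ x → tally f m + x) (trans (tally-cong periodic (q * m)) (tally-periodic m periodic q)))

-- The index k stands for the number k + 1, so the multiples of q + 1 sit at the last place of each
-- block of length q + 1.
tally-sparse : ∀ {f} q → (∀ k → ¬ suc q ∣ suc k → f k ≡ 0) →
  ∀ m → tally f (m * suc q) ≡ tally (λ i → f (q + i * suc q)) m
tally-sparse {f} q sparse zero    = refl
tally-sparse {f} q sparse (suc m) = begin
  tally f (suc q + m * suc q)
    ≡⟨ tally-++ f (suc q) (m * suc q) ⟩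
  tally f (suc q) + tally (λ k → f (suc q + k)) (m * suc q)
    ≡⟨ cong₂ _+_ (trans (tally-suc f q) (cong (_+ f q) (tally-zero q λ k<q →
         sparse _ (>⇒∤ (s≤s k<q))))) (tally-sparse q sparse′ m) ⟩
  f q + tally (λ i → f (suc q + (q + i * suc q))) m
    ≡⟨ cong₂ _+_ (cong f (sym (+-identityʳ q)))
         (tally-cong (λ i → cong f (ℕ+.x∙yz≈y∙xz (suc q) q (i * suc q))) m) ⟩
  f (q + 0) + tally (λ i → f (q + (suc q + i * suc q))) m ∎
  where
  open ≡-Reasoning
  sparse′ : ∀ k → ¬ suc q ∣ suc k → f (suc q + k) ≡ 0
  sparse′ k ∤k = sparse (suc q + k) λ d →
    ∤k (∣m+n∣m⇒∣n (subst (suc q ∣_) (sym (+-suc (suc q) k)) d) ∣-refl)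

indicator : ∀ {a} {A : Set a} → Dec A → ℕ
indicator a? = if does a? then 1 else 0

indicator-cong : ∀ {a b} {A : Set a} {B : Set b} (a? : Dec A) (b? : Dec B) →
  (A → B) → (B → A) → indicator a? ≡ indicator b?
indicator-cong (yes a) (yes b) f g = refl
indicator-cong (yes a) (no ¬b) f g = contradiction (f a) ¬b
indicator-cong (no ¬a) (yes b) f g = contradiction (g b) ¬a
indicator-cong (no ¬a) (no ¬b) f g = refl

indicator-yes : ∀ {a} {A : Set a} → A → (a? : Dec A) → indicator a? ≡ 1
indicator-yes a (yes _) = refl
indicator-yes a (no ¬a) = contradiction a ¬a

indicator-no : ∀ {a} {A : Set a} → ¬ A → (a? : Dec A) → indicator a? ≡ 0
indicator-no ¬a (yes a) = contradiction a ¬a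
indicator-no ¬a (no _)  = refl

length-filter-applyUpTo : ∀ {p} {P : Pred ℕ p} (P? : Decidable P) f n →
  length (filter P? (applyUpTo f n)) ≡ tally (λ k → indicator (P? (f k))) n
length-filter-applyUpTo P? f zero = refl
length-filter-applyUpTo P? f (suc n) with P? (f 0)
... | yes _ = cong suc (length-filter-applyUpTo P? (f ∘ suc) n)
... | no  _ = length-filter-applyUpTo P? (f ∘ suc) n

χ : ℕ → ℕ → ℕ
χ m x = indicator (coprime? x m)

φ-tally : ∀ n → φ n ≡ tally (χ n ∘ suc) n
φ-tally n = length-filter-applyUpTo (λ k → coprime? k n) suc n

χ-periodic : ∀ m x → χ m (suc (m + x)) ≡ χ m (suc x)
χ-periodic m x = trans (cong (χ m) (sym (+-suc m x))) (indicator-cong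
  (coprime? (m + suc x) m) (coprime? (suc x) m)
  (λ c (d∣1+x , d∣m) → c (∣m∣n⇒∣m+n d∣m d∣1+x , d∣m)) (λ c → coprime-+ c))

tally-χ : ∀ m q → tally (χ m ∘ suc) (q * m) ≡ q * φ m
tally-χ m q = trans (tally-periodic m (χ-periodic m) q) (cong (q *_) (sym (φ-tally m)))

-- For p ∣ m, being coprime to pm and being coprime to m are the same, and the range up to pm
-- consists of p periods of `χ m`.
φ-*-∣ : ∀ {p m} → p ∣ m → φ (p * m) ≡ p * φ m
φ-*-∣ {p} {m} p∣m = begin
  φ (p * m)                            ≡⟨ φ-tally (p * m) ⟩
  tally (χ (p * m) ∘ suc) (p * m)      ≡⟨ tally-cong (λ k → χ-* (suc k)) (p * m) ⟩
  tally (χ m ∘ suc) (p * m)            ≡⟨ tally-χ m p ⟩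
  p * φ m                              ∎
  where
  open ≡-Reasoning
  χ-* : ∀ x → χ (p * m) x ≡ χ m x
  χ-* x = indicator-cong (coprime? x (p * m)) (coprime? x m)
    (λ c (d∣x , d∣m) → c (d∣x , ∣n⇒∣m*n p d∣m))
    -- A common divisor of d and p divides both x and m, hence is 1; so p can be cancelled from d ∣
    -- pm.
    (λ c (d∣x , d∣pm) → c (d∣x , coprime-divisor
      (λ (e∣d , e∣p) → c (∣-trans e∣d d∣x , ∣-trans e∣p p∣m)) d∣pm))

prime-cancel : ∀ {p d x m} → Prime p → ¬ p ∣ x → d ∣ x → d ∣ p * m → d ∣ m
prime-cancel {p} {d} pr p∤x d∣x = coprime-divisor coprime
  where
  coprime : Coprime d p
  coprime (e∣d , e∣p) with prime⇒irreducible pr e∣p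
  ... | inj₁ e≡1  = e≡1
  ... | inj₂ refl = contradiction (∣-trans e∣d d∣x) p∤x

-- Of the p φ(m) numbers up to pm that are coprime to m, those prime to p are coprime to pm, and the
-- others are the numbers p i with i ≤ m coprime to m. The count is kept additive and φ(m) cancelled
-- at the end.
φ-*-∤ : ∀ {p m} → Prime p → ¬ p ∣ m → φ (p * m) ≡ pred p * φ m
φ-*-∤ {zero}      {m} pr p∤m = contradiction pr ¬prime[0]
φ-*-∤ {p@(suc q)} {m} pr p∤m = +-cancelˡ-≡ (φ m) (φ (p * m)) (q * φ m) (begin
  φ m + φ (p * m)
    ≡⟨ +-comm (φ m) (φ (p * m)) ⟩
  φ (p * m) + φ m
    ≡⟨ cong₂ _+_ (φ-tally (p * m)) (sym tally-μ) ⟩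
  tally (χ (p * m) ∘ suc) (p * m) + tally (μ ∘ suc) (p * m)
    ≡⟨ tally-distrib-+ (χ (p * m) ∘ suc) (μ ∘ suc) (p * m) ⟨
  tally (λ k → χ (p * m) (suc k) + μ (suc k)) (p * m)
    ≡⟨ tally-cong (λ k → χ-split (suc k)) (p * m) ⟩
  tally (χ m ∘ suc) (p * m)
    ≡⟨ tally-χ m p ⟩
  p * φ m ∎)
  where
  open ≡-Reasoning
  μ : ℕ → ℕ
  μ x = indicator (p ∣? x) * χ m x
  μ-∣ : ∀ {x} → p ∣ x → μ x ≡ χ m x
  μ-∣ {x} p∣x = trans (cong (_* χ m x) (indicator-yes p∣x (p ∣? x))) (*-identityˡ (χ m x))
  μ-∤ : ∀ {x} → ¬ p ∣ x → μ x ≡ 0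
  μ-∤ {x} p∤x = cong (_* χ m x) (indicator-no p∤x (p ∣? x))
  χ-split : ∀ x → χ (p * m) x + μ x ≡ χ m x
  χ-split x = by-cases (p ∣? x)
    where
    by-cases : Dec (p ∣ x) → χ (p * m) x + μ x ≡ χ m x
    by-cases (yes p∣x) = cong₂ _+_
      (indicator-no (λ c → prime∤1 pr (∣-reflexive (c (p∣x , m∣m*n m)))) (coprime? x (p * m)))
      (μ-∣ p∣x)
    by-cases (no p∤x) = trans (cong₂ _+_
      (indicator-cong (coprime? x (p * m)) (coprime? x m)
        (λ c (d∣x , d∣m) → c (d∣x , ∣n⇒∣m*n p d∣m))
        (λ c (d∣x , d∣pm) → c (d∣x , prime-cancel pr p∤x d∣x d∣pm)))
      (μ-∤ p∤x)) (+-identityʳ (χ m x))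
  χ-p* : ∀ i → χ m (p * i) ≡ χ m i
  χ-p* i = indicator-cong (coprime? (p * i) m) (coprime? i m)
    (λ c (d∣i , d∣m) → c (∣n⇒∣m*n p d∣i , d∣m))
    (λ c (d∣pi , d∣m) → c (prime-cancel pr p∤m d∣m d∣pi , d∣m))
  μ-p* : ∀ i → μ (suc (q + i * p)) ≡ χ m (suc i)
  μ-p* i = begin
    μ (suc i * p)   ≡⟨ μ-∣ (n∣m*n (suc i)) ⟩
    χ m (suc i * p) ≡⟨ cong (χ m) (*-comm (suc i) p) ⟩
    χ m (p * suc i) ≡⟨ χ-p* (suc i) ⟩
    χ m (suc i)     ∎
  tally-μ : tally (μ ∘ suc) (p * m) ≡ φ m
  tally-μ = begin
    tally (μ ∘ suc) (p * m)                  ≡⟨ cong (tally (μ ∘ suc)) (*-comm p m) ⟩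
    tally (μ ∘ suc) (m * p)                  ≡⟨ tally-sparse q (λ _ → μ-∤) m ⟩
    tally (λ i → μ (suc (q + i * p))) m      ≡⟨ tally-cong μ-p* m ⟩
    tally (χ m ∘ suc) m                      ≡⟨ φ-tally m ⟨
    φ m                                      ∎

-- Factors p are stripped from n one at a time: while p still divides the cofactor, `φ` is only
-- multiplied by p, and the last factor contributes p-1.
p-1∣φ : ∀ {p} → Prime p → ∀ n → .{{NonZero n}} → p ∣ n → pred p ∣ φ n
p-1∣φ {p} pr = <-rec _ go
  where
  go : ∀ n → (∀ {m} → m < n → .{{NonZero m}} → p ∣ m → pred p ∣ φ m) → .{{NonZero n}} → p ∣ n → pred p ∣ φ n
  go n rec {{n≢0}} (divides m n≡m*p) = subst (λ n → pred p ∣ φ n) (sym n≡p*m) pred[p]∣φ[p*m]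
    where
    n≡p*m : n ≡ p * m
    n≡p*m = trans n≡m*p (*-comm m p)
    instance
      m≢0 : NonZero m
      m≢0 = m*n≢0⇒n≢0 p {{subst NonZero n≡p*m n≢0}}
    pred[p]∣φ[p*m] : pred p ∣ φ (p * m)
    pred[p]∣φ[p*m] with p ∣? m
    ... | no  p∤m = subst (pred p ∣_) (sym (φ-*-∤ pr p∤m)) (m∣m*n (φ m))
    ... | yes p∣m = subst (pred p ∣_) (sym (φ-*-∣ p∣m)) (∣n⇒∣m*n p (rec m<n p∣m))
      where
      m<n : m < n
      m<n = subst (m <_) (sym n≡m*p) (m<m*n m p (nonTrivial⇒n>1 p {{prime⇒nonTrivial pr}}))

-- Periodicity modulo p

iterate-period : ∀ {m} (y : ℕ → ℤ) e → (∀ t → y (e + t) ≈ y t mod m) → ∀ i t → y (i * e + t) ≈ y t mod m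
iterate-period y e periodic zero t = ≈-refl
iterate-period y e periodic (suc i) t = ≈-trans
  (≈-reflexive (cong y (+-assoc e (i * e) t)))
  (≈-trans (periodic (i * e + t)) (iterate-period y e periodic i t))

-- The difference d of y over one period e of g satisfies d (suc t) ≡ c d t, hence
-- has period e by Fermat, so y increases by p d ≡ 0 over p periods.
affine-period : ∀ {p} → Prime p → ∀ {c} → ¬ p ∣ c → ∀ {y g : ℕ → ℤ} →
  (∀ t → y (suc t) ≈ + c ℤ.* (y t ℤ.+ g t) mod p) →
  ∀ {e} → pred p ∣ e → (∀ t → g (e + t) ≈ g t mod p) →
  ∀ t → y (p * e + t) ≈ y t mod p
affine-period {p} pr {c} p∤c {y} {g} y-suc {e} p-1∣e g-period t = begin
  y (p * e + t)             ≈⟨ accumulate p t ⟩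
  y t ℤ.+ + p ℤ.* d t       ≈⟨ +-cong-≈ (≈-refl {a = y t}) (*-cong-≈ {a = + p} {b = 0ℤ} {c = d t} (∣⇒≈0 ∣-refl) ≈-refl) ⟩
  y t ℤ.+ 0ℤ ℤ.* d t        ≡⟨ ℤ.+-identityʳ (y t) ⟩
  y t                       ∎
  where
  open ≈-Reasoning p
  d : ℕ → ℤ
  d t = y (e + t) ℤ.- y t
  distrib : ∀ c a b g → c ℤ.* (a ℤ.+ g) ℤ.- c ℤ.* (b ℤ.+ g) ≡ c ℤ.* (a ℤ.- b)
  distrib = solve-∀
  d-suc : ∀ t → d (suc t) ≈ + c ℤ.* d t mod p
  d-suc t = begin
    y (e + suc t) ℤ.- y (suc t)
      ≡⟨ cong (λ i → y i ℤ.- y (suc t)) (+-suc e t) ⟩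
    y (suc (e + t)) ℤ.- y (suc t)
      ≈⟨ -‿cong-≈ (y-suc (e + t)) (y-suc t) ⟩
    + c ℤ.* (y (e + t) ℤ.+ g (e + t)) ℤ.- + c ℤ.* (y t ℤ.+ g t)
      ≈⟨ -‿cong-≈ (*-cong-≈ (≈-refl {a = + c}) (+-cong-≈ (≈-refl {a = y (e + t)}) (g-period t)))
           (≈-refl {a = + c ℤ.* (y t ℤ.+ g t)}) ⟩
    + c ℤ.* (y (e + t) ℤ.+ g t) ℤ.- + c ℤ.* (y t ℤ.+ g t)
      ≡⟨ distrib (+ c) (y (e + t)) (y t) (g t) ⟩
    + c ℤ.* d t ∎
  d-+ : ∀ s t → d (s + t) ≈ (+ c) ℤ.^ s ℤ.* d t mod p
  d-+ zero    t = ≈-reflexive (sym (ℤ.*-identityˡ (d t)))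
  d-+ (suc s) t = ≈-trans (d-suc (s + t)) (≈-trans
    (*-cong-≈ (≈-refl {a = + c}) (d-+ s t))
    (≈-reflexive (sym (ℤ.*-assoc (+ c) ((+ c) ℤ.^ s) (d t)))))
  d-period : ∀ t → d (e + t) ≈ d t mod p
  d-period t = ≈-trans (d-+ e t) (≈-trans
    (*-cong-≈ (x^k≈1 (c^[p-1]≈1 pr p∤c) p-1∣e) (≈-refl {a = d t}))
    (≈-reflexive (ℤ.*-identityˡ (d t))))
  accumulate : ∀ i t → y (i * e + t) ≈ y t ℤ.+ + i ℤ.* d t mod p
  accumulate zero    t = ≈-reflexive (sym (ℤ.+-identityʳ (y t)))
  accumulate (suc i) t = begin
    y (e + i * e + t)
      ≡⟨ cong y (+-assoc e (i * e) t) ⟩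
    y (e + (i * e + t))
      ≡⟨ add-back (y (e + (i * e + t))) (y (i * e + t)) ⟩
    d (i * e + t) ℤ.+ y (i * e + t)
      ≈⟨ +-cong-≈ (iterate-period d e d-period i t) (accumulate i t) ⟩
    d t ℤ.+ (y t ℤ.+ + i ℤ.* d t)
      ≡⟨ collect (d t) (y t) (+ i) ⟩
    y t ℤ.+ (1ℤ ℤ.+ + i) ℤ.* d t ∎
    where
    add-back : ∀ a b → a ≡ (a ℤ.- b) ℤ.+ b
    add-back = solve-∀
    collect : ∀ d y i → d ℤ.+ (y ℤ.+ i ℤ.* d) ≡ y ℤ.+ (1ℤ ℤ.+ i) ℤ.* d
    collect = solve-∀

-- Since binom l j vanishes for l < j, step N is triangular, and periods are found
-- by descending induction on j, here recorded as the condition N < j + h.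
orbit-period-above : ∀ {p} → Prime p → ∀ N h → ∃ λ e → NonZero e × pred p ∣ e ×
  (∀ {j} → j ≤ N → N < j + h → ∀ t → orbit N (suc (e + t)) j ≈ orbit N (suc t) j mod p)
orbit-period-above {zero} pr N h = contradiction pr ¬prime[0]
orbit-period-above {suc zero} pr N h = contradiction pr ¬prime[1]
-- No j qualifies when h = 0. Starting from e = p-1 keeps every later e a nonzero multiple of p-1,
-- as `affine-period` requires.
orbit-period-above {p@(suc (suc _))} pr N zero = pred p , _ , ∣-refl ,
  λ {j} j≤N N<j+0 → contradiction (subst (N <_) (+-identityʳ j) N<j+0) (≤⇒≯ j≤N)
orbit-period-above {p@(suc (suc _))} pr N (suc h) with orbit-period-above pr N h
... | e , e≢0 , p-1∣e , above = p * e , m*n≢0 p e {{_}} {{e≢0}} , ∣n⇒∣m*n p p-1∣e , period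
  where
  period : ∀ {j} → j ≤ N → N < j + suc h →
    ∀ t → orbit N (suc (p * e + t)) j ≈ orbit N (suc t) j mod p
  period {j} j≤N N<j+1+h with p ∣? (N C j)
  -- Such a component is zero modulo p after one step, but possibly not at the start; hence
  -- periodicity is claimed from time 1 on.
  ... | yes p∣C = λ t → ≈-trans (vanish (p * e + t)) (≈-sym (vanish t))
    where
    vanish : ∀ t → orbit N (suc t) j ≈ 0ℤ mod p
    vanish t = *-cong-≈ {a = binom N j} {b = 0ℤ} {c = s} {d = s} (∣⇒≈0 p∣C) ≈-refl
      where s = ∑[ l < suc N ] (binom (toℕ l) j ℤ.* orbit N t (toℕ l))
  ... | no  p∤C = affine-period pr p∤C {y} {g} (λ t → ≈-reflexive (y-suc t)) p-1∣e g-period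
    where
    i : Fin (suc N)
    i = fromℕ< (s≤s j≤N)
    toℕ-i : toℕ i ≡ j
    toℕ-i = toℕ-fromℕ< (s≤s j≤N)
    y g : ℕ → ℤ
    term : ℕ → Fin (suc N) → ℤ
    term t l = binom (toℕ l) j ℤ.* orbit N (suc t) (toℕ l)
    y t = orbit N (suc t) j
    -- The diagonal term l = j is `y t` because C(j,j) = 1; everything else is the inhomogeneous
    -- part.
    g t = ∑[ l < N ] term t (punchIn i l)
    term-i : ∀ t → term t i ≡ y t
    term-i t rewrite toℕ-i | nCn≡1 j = ℤ.*-identityˡ (y t)
    y-suc : ∀ t → y (suc t) ≡ + (N C j) ℤ.* (y t ℤ.+ g t)
    y-suc t = cong (binom N j ℤ.*_) (trans
      (sum-remove {N} {i} (term t)) (cong (λ x → x ℤ.+ g t) (term-i t)))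
    term-period : ∀ t l → toℕ l ≢ j → term (e + t) l ≈ term t l mod p
    -- For l > j the hypothesis for h applies, as j + 1 + h ≤ l + h; for l < j the coefficient
    -- C(l,j) is zero.
    term-period t l l≢j with j <? toℕ l
    ... | yes j<l = *-cong-≈ {a = binom (toℕ l) j} ≈-refl
      (above (≤-pred (toℕ<n l)) (<-≤-trans N<j+1+h
        (subst (_≤ toℕ l + h) (sym (+-suc j h)) (+-monoˡ-≤ h j<l))) t)
    ... | no  j≮l rewrite k>n⇒nCk≡0 (≤∧≢⇒< (≮⇒≥ j≮l) l≢j) = ≈-refl {a = 0ℤ}
    g-period : ∀ t → g (e + t) ≈ g t mod p
    g-period t = sum-cong-≈ {n = N} λ l → term-period t (punchIn i l)
      (λ eq → punchInᵢ≢i i l (toℕ-injective (trans eq (sym toℕ-i))))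

orbit-period : ∀ {p} → Prime p → ∀ N → ∃ λ e → NonZero e ×
  (∀ t → orbit N (suc (e + t)) 0 ≈ orbit N (suc t) 0 mod p)
-- h = N + 1 is the least value that admits j = 0.
orbit-period pr N with orbit-period-above pr N (suc N)
... | e , e≢0 , _ , period = e , e≢0 , period z≤n (n<1+n N)

-- Valuations

p^k∣ab⇒p^k∣a : ∀ {p} → Prime p → ∀ k a {b} → ¬ p ∣ b → p ^ k ∣ a * b → p ^ k ∣ a
p^k∣ab⇒p^k∣a         pr zero    a     p∤b d = 1∣ a
p^k∣ab⇒p^k∣a {p} pr (suc k) a {b} p∤b d
  with euclidsLemma a b pr (∣-trans (m∣m*n (p ^ k)) d)
... | inj₂ p∣b              = contradiction p∣b p∤b
... | inj₁ (divides-refl q) = subst (p * p ^ k ∣_) (*-comm p q)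
  (*-monoʳ-∣ p (p^k∣ab⇒p^k∣a pr k q p∤b
    (*-cancelˡ-∣ p {{prime⇒nonZero pr}} (subst (p * p ^ k ∣_) (regroup q p b) d))))
  where
  regroup : ∀ q p b → q * p * b ≡ p * (q * b)
  regroup = ℕ-solve-∀

ν-*-unit : ∀ {p} → Prime p → ∀ {m} → m ≢ 0ℤ → ∀ {z} → ¬ p ∣ ∣ z ∣ → ν p (m ℤ.* z) ≡ ν p m
ν-*-unit {p} pr {m} m≢0 {z} p∤z
  with ν-greatest 2≤p m*z≢0 | ν-greatest 2≤p m≢0
  where
  2≤p : 2 ≤ p
  2≤p = nonTrivial⇒n>1 p {{prime⇒nonTrivial pr}}
  m*z≢0 : m ℤ.* z ≢ 0ℤ
  m*z≢0 eq with ℤ.i*j≡0⇒i≡0∨j≡0 m eq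
  ... | inj₁ m≡0  = m≢0 m≡0
  ... | inj₂ refl = p∤z (p ∣0)
... | v , ν≡v , p^v∣mz , max | w , ν≡w , p^w∣m , max′ = begin
  ν p (m ℤ.* z) ≡⟨ ν≡v ⟩
  [ v ]         ≡⟨ cong [_] (≤-antisym v≤w w≤v) ⟩
  [ w ]         ≡⟨ ν≡w ⟨
  ν p m         ∎
  where
  open ≡-Reasoning
  v≤w : v ≤ w
  v≤w = max′ (p^k∣ab⇒p^k∣a pr v ∣ m ∣ p∤z (subst (p ^ v ∣_) (ℤ.abs-* m z) p^v∣mz))
  w≤v : w ≤ v
  w≤v = max (subst (p ^ w ∣_) (sym (ℤ.abs-* m z)) (∣m⇒∣m*n ∣ z ∣ p^w∣m))

-- Power sums modulo a prime power, and the conclusion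

c^k≈0 : ∀ {p c} → p ∣ c → ∀ {a k} → a ≤ k → (+ c) ℤ.^ k ≈ 0ℤ mod p ^ a
c^k≈0 {p} {c} p∣c {a} {k} a≤k = ≈-trans (≈-reflexive (sym (pos-^ c k))) (∣⇒≈0
  (subst (λ i → p ^ a ∣ c ^ i) (m+[n∸m]≡n a≤k)
    (subst (p ^ a ∣_) (sym (^-distribˡ-+-* c a (k ∸ a))) (∣m⇒∣m*n (c ^ (k ∸ a)) (p^i∣c^i a)))))
  where
  p^i∣c^i : ∀ i → p ^ i ∣ c ^ i
  p^i∣c^i zero    = ∣-refl
  p^i∣c^i (suc i) = *-pres-∣ p∣c (p^i∣c^i i)

-- The congruence holds term by term. Bases divisible by p give 0 on both sides, both exponents
-- exceeding a; for the other bases the powers with exponents s and t are 1.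
alternatingPowerSum-≈ : ∀ {p} → Prime p → ∀ n a {s t} → a < s → a < t →
  pred p * p ^ a ∣ s → pred p * p ^ a ∣ t →
  alternatingPowerSum n (2 + s) ≈ alternatingPowerSum n (2 + t) mod p ^ suc a
alternatingPowerSum-≈ {p} pr n a {s} {t} a<s a<t ∣s ∣t = sum-cong-≈ {n = suc (2 * n)} λ k →
  *-cong-≈ {a = -1ℤ ℤ.^ toℕ k} ≈-refl (≈-trans
    (≈-reflexive (pos-^ ((2 * n) C toℕ k) (2 + s)))
    (≈-trans (powers ((2 * n) C toℕ k))
    (≈-reflexive (sym (pos-^ ((2 * n) C toℕ k) (2 + t))))))
  where
  powers : ∀ c → (+ c) ℤ.^ (2 + s) ≈ (+ c) ℤ.^ (2 + t) mod p ^ suc a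
  powers c with p ∣? c
  ... | yes p∣c = ≈-trans (c^k≈0 p∣c (m≤n⇒m≤o+n 2 a<s)) (≈-sym (c^k≈0 p∣c (m≤n⇒m≤o+n 2 a<t)))
  ... | no  p∤c = *-cong-≈ {a = + c} ≈-refl (*-cong-≈ {a = + c} ≈-refl
    (≈-trans (c^k≈1 pr a p∤c ∣s) (≈-sym (c^k≈1 pr a p∤c ∣t))))

2nCn≢0 : ∀ n → binom (2 * n) n ≢ 0ℤ
2nCn≢0 n eq = ≢-nonZero⁻¹ ((2 * n) !) {{(2 * n) !≢0}} (trans
  (sym (nCk*k![n∸k]!≡n! (n≤2n n)))
  (cong (_* (n ! * (2 * n ∸ n) !)) (ℤ.+-injective eq)))

∣-1^n∣ : ∀ n → ∣ -1ℤ ℤ.^ n ∣ ≡ 1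
∣-1^n∣ zero    = refl
∣-1^n∣ (suc n) = trans (ℤ.abs-* -1ℤ (-1ℤ ℤ.^ n)) (trans (+-identityʳ _) (∣-1^n∣ n))

prime∤orbit-1 : ∀ {p} → Prime p → ∀ n → ¬ p ∣ ∣ orbit (2 * n) 1 0 ∣
prime∤orbit-1 {p} pr n p∣ = prime∤1 pr (subst (p ∣_) (trans (cong ∣_∣ (orbit-1 n)) (∣-1^n∣ n)) p∣)

prime∤orbit : ∀ {p} → Prime p → ∀ n s → p ∣ ((2 * n) C n) →
  φ ((2 * n) C n) * ((2 * n) C n) ∣ s → ¬ p ∣ ∣ orbit (2 * n) (suc s) 0 ∣
-- This is r = 2; it is separate because the comparison below needs s > v.
prime∤orbit pr n zero _ _ = prime∤orbit-1 pr n
prime∤orbit {p} pr n s@(suc _) p∣M K∣s p∣orbit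
  with ν-greatest (nonTrivial⇒n>1 p {{prime⇒nonTrivial pr}}) (2nCn≢0 n) | orbit-period pr (2 * n)
... | v , _ , p^v∣M , max | e , e≢0 , period =
  -- The assumption p ∣ z(s+1,0) makes S(2+s), hence S(2+se), divisible by p^(v+1). As p does not
  -- divide z(se+1,0), the power divides M, and `max` yields v + 1 ≤ v.
  n≮n v (max (p^k∣ab⇒p^k∣a pr (suc v) M p∤orbit′ (subst (p ^ suc v ∣_) (ℤ.abs-* (+ M) orbit′)
    (≈0⇒∣ (≈-trans (≈-reflexive (sym (alternatingPowerSum-orbit n (suc (s * e)))))
      (≈-trans (≈-sym (alternatingPowerSum-≈ pr n v v<s (<-≤-trans v<s s≤s*e) ∣s (∣m⇒∣m*n e ∣s)))
      (≈-trans (≈-reflexive (alternatingPowerSum-orbit n (suc s))) M*orbit≈0)))))))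
  where
  M : ℕ
  M = (2 * n) C n
  orbit′ : ℤ
  orbit′ = orbit (2 * n) (suc (s * e)) 0
  -- s e is a multiple of s and also consists of s periods of length e, so it leads back to time 1.
  orbit′≈orbit-1 : orbit′ ≈ orbit (2 * n) 1 0 mod p
  orbit′≈orbit-1 = ≈-trans
    (≈-reflexive (cong (λ i → orbit (2 * n) (suc i) 0) (sym (+-identityʳ (s * e)))))
    (iterate-period (λ t → orbit (2 * n) (suc t) 0) e period s 0)
  p∤orbit′ : ¬ p ∣ ∣ orbit′ ∣
  p∤orbit′ p∣orbit′ = prime∤orbit-1 pr n (≈0⇒∣ (≈-trans (≈-sym orbit′≈orbit-1) (∣⇒≈0 p∣orbit′)))
  ∣s : pred p * p ^ v ∣ s
  -- p-1 divides φ(M) and pᵛ divides M, so the product divides φ(M) M.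
  ∣s = ∣-trans (*-pres-∣ (p-1∣φ pr M {{≢-nonZero (λ eq → 2nCn≢0 n (cong +_ eq))}} p∣M) p^v∣M) K∣s
  v<s : v < s
  -- v < pᵛ ≤ s, because pᵛ divides M, hence the nonzero number s.
  v<s = <-≤-trans (n<p^n (nonTrivial⇒n>1 p {{prime⇒nonTrivial pr}}) v)
    (∣⇒≤ (∣-trans p^v∣M (∣-trans (n∣m*n (φ M)) K∣s)))
  s≤s*e : s ≤ s * e
  s≤s*e = m≤m*n s e {{e≢0}}
  M*orbit≈0 : + M ℤ.* orbit (2 * n) (suc s) 0 ≈ 0ℤ mod p ^ suc v
  M*orbit≈0 = ∣⇒≈0 (subst₂ _∣_ (*-comm (p ^ v) p) (sym (ℤ.abs-* (+ M) (orbit (2 * n) (suc s) 0)))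
    (*-pres-∣ p^v∣M p∣orbit))

theorem1 : ∀ (n r : ℕ) .{{_ : NonZero n}} .{{_ : NonZero r}} →
    + r ≡ + 2 [mod φ ((2 * n) C n) * ((2 * n) C n) ] →
    ∀ {p} → Prime p → p ∣ ((2 * n) C n) →
    ν p (alternatingPowerSum n r) ≡ ν p (+ ((2 * n) C n))
-- r = 1 is impossible: the modulus, and with it p, would divide 1.
theorem1 n (suc zero) r≡2 pr p∣M =
  contradiction (∣-trans p∣M (∣-trans (n∣m*n (φ ((2 * n) C n))) r≡2)) (prime∤1 pr)
-- Here r - 2 computes to s, so the hypothesis is literally the divisibility of s that `prime∤orbit`
-- expects.
theorem1 n (suc (suc s)) r≡2 {p} pr p∣M = trans
  (cong (ν p) (alternatingPowerSum-orbit n (suc s)))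
  (ν-*-unit pr (2nCn≢0 n) (prime∤orbit pr n s p∣M r≡2))
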